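{- Let $n\ge 2$ be an integer and let $F_n$ be the friendship graph, i.e. the graph with $2n+1$ vertices and $3n$ edges obtained from $n$ copies of the triangle $C_3$ by identifying one vertex from each copy into a single common vertex. Then: (i) the Randić characteristic polynomial of $F_n$ is $RP(F_n,\lambda)=\left(\lambda^2-\frac14\right)^{n-1}(\lambda-1)\left(\lambda+\frac12\right)^2$; (ii) the Randić energy of $F_n$ is $RE(F_n)=n+1$.
   Context: All graphs are finite and simple. For a graph $G$ with vertices $v_1,\dots,v_N$ of degrees $d_1,\dots,d_N$, the Randić matrix $R(G)$ is the $N\times N$ real symmetric matrix with $(i,j)$-entry $\frac{1}{\sqrt{d_id_j}}$ if $v_i$ and $v_j$ are adjacent, and $0$ otherwise. The Randić characteristic polynomial of $G$ is $RP(G,\lambda)=\det(\lambda I-R(G))$. The Randić energy of $G$ is $RE(G)=\sum_{i=1}^N|\rho_i|$, where $\rho_1,\dots,\rho_N$ are the eigenvalues of $R(G)$ counted with multiplicity. -}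

module Defs where

open import Algebra.Bundles using (RawRing)
import Algebra.Definitions.RawSemiring as RawSemiringDefinitions
open import Data.Empty using (⊥)
open import Data.Fin.Base using (Fin; zero; suc; toℕ; punchIn; quotient)
import Data.Fin.Properties as Fin
open import Data.Integer.Base using (+_; +[1+_]; -[1+_])
import Data.Integer.Base as ℤ
import Data.Integer.Properties as ℤ
import Data.Integer.Tactic.RingSolver as ℤSolver
open import Data.List.Base using (List; []; _∷_; length; filter; allFin; map)
open import Data.List.Membership.Propositional using (_∈_)
open import Data.List.Membership.Propositional.Properties using (∈-allFin; ∈-filter⁺)
open import Data.Nat.Base using (ℕ; zero; suc; z≤n; s≤s)
import Data.Nat.Base as ℕ
import Data.Nat.Properties as ℕ
open import Data.Nat.Tactic.RingSolver using (solve-∀)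
open import Data.Product.Base using (∃; ∃-syntax; _×_; _,_)
open import Data.Rational.Base using (ℚ; mkℚ; 0ℚ; 1ℚ; _/_; fromℚᵘ; toℚᵘ)
import Data.Rational.Base as ℚ
import Data.Rational.Properties as ℚ
open import Data.Rational.Solver using (module +-*-Solver)
open import Data.Rational.Unnormalised.Base using (mkℚᵘ; *≡*; *<*; *≤*)
import Data.Rational.Unnormalised.Base as ℚᵘ
import Data.Rational.Unnormalised.Properties as ℚᵘ
open import Data.Sum.Base using (inj₁; inj₂)
open import Data.Unit.Base using (⊤; tt)
open import Data.Vec.Functional using (Vector)
open import Level using (0ℓ)
open import Relation.Binary.Core using (Rel)
open import Relation.Binary.Definitions using (Decidable; Irreflexive; Symmetric)
open import Relation.Binary.PropositionalEquality
open import Relation.Nullary using (yes; no; contradiction; ¬?)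
open import Relation.Nullary.Decidable using (_×-dec_)

module RationalLemmas where
  open import Data.Rational.Base using (_<_; _≤_; _+_; _*_; _-_; -_; ∣_∣; ½; Positive)
  open ℚ.≤-Reasoning
  open +-*-Solver using (solve; _:=_; _:+_; _:*_; _:-_; :-_)

  ½* : ∀ {ε} → 0ℚ < ε → 0ℚ < ½ * ε
  ½* {ε} ε>0 = ℚ.positive⁻¹ _ {{ℚ.pos*pos⇒pos ½ ε {{ℚ.positive ε>0}}}}

  halves : ∀ ε → ½ * ε + ½ * ε ≡ ε
  halves ε = trans (sym (ℚ.*-distribʳ-+ ε ½ ½)) (ℚ.*-identityˡ ε)

  ∣p-q∣≡∣q-p∣ : ∀ p q → ∣ p - q ∣ ≡ ∣ q - p ∣
  ∣p-q∣≡∣q-p∣ p q = trans (sym (ℚ.∣-p∣≡∣p∣ (p - q)))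
    (cong ∣_∣ (solve 2 (λ a b → :- (a :- b) := b :- a) refl p q))

  p<q+r⇒p-q<r : ∀ p q r → p < q + r → p - q < r
  p<q+r⇒p-q<r p q r h = begin-strict
    p - q       <⟨ ℚ.+-monoˡ-< (- q) h ⟩
    q + r - q   ≡⟨ solve 2 (λ b c → b :+ c :- b := c) refl q r ⟩
    r           ∎

  ∣∣-< : ∀ p r → p < r → - p < r → ∣ p ∣ < r
  ∣∣-< p r h₁ h₂ with ℚ.∣p∣≡p∨∣p∣≡-p p
  ... | inj₁ e = subst (_< r) (sym e) h₁
  ... | inj₂ e = subst (_< r) (sym e) h₂

  p≤∣p∣ : ∀ p → p ≤ ∣ p ∣
  p≤∣p∣ (mkℚ (+ n)    _ _) = ℚ.≤-refl
  p≤∣p∣ (mkℚ -[1+ n ] _ _) = ℚ.*≤* ℤ.-≤+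

  ∣p∣-∣q∣≤∣p-q∣ : ∀ p q → ∣ p ∣ ≤ ∣ q ∣ + ∣ p - q ∣
  ∣p∣-∣q∣≤∣p-q∣ p q = begin
    ∣ p ∣               ≡⟨ cong ∣_∣ (solve 2 (λ a b → a := b :+ (a :- b)) refl p q) ⟩
    ∣ q + (p - q) ∣     ≤⟨ ℚ.∣p+q∣≤∣p∣+∣q∣ q (p - q) ⟩
    ∣ q ∣ + ∣ p - q ∣   ∎

  ∣∣p∣-∣q∣∣≤∣p-q∣ : ∀ {ε} p q → ∣ p - q ∣ < ε → ∣ ∣ p ∣ - ∣ q ∣ ∣ < ε
  ∣∣p∣-∣q∣∣≤∣p-q∣ {ε} p q h = ∣∣-< _ _ (half p q h)
    (subst (_< ε) (solve 2 (λ a b → b :- a := :- (a :- b)) refl ∣ p ∣ ∣ q ∣)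
      (half q p (subst (_< ε) (∣p-q∣≡∣q-p∣ p q) h)))
    where
    half : ∀ p q → ∣ p - q ∣ < ε → ∣ p ∣ - ∣ q ∣ < ε
    half p q h = p<q+r⇒p-q<r ∣ p ∣ ∣ q ∣ ε
      (ℚ.≤-<-trans (∣p∣-∣q∣≤∣p-q∣ p q) (ℚ.+-monoʳ-< ∣ q ∣ h))

  ∣*∣-mono : ∀ p q {a b} → ∣ p ∣ ≤ a → ∣ q ∣ ≤ b → ∣ p * q ∣ ≤ a * b
  ∣*∣-mono p q {a} {b} h₁ h₂ = begin
    ∣ p * q ∣       ≡⟨ ℚ.∣p*q∣≡∣p∣*∣q∣ p q ⟩
    ∣ p ∣ * ∣ q ∣   ≤⟨ ℚ.*-monoʳ-≤-nonNeg ∣ q ∣ {{ℚ.∣-∣-nonNeg q}} h₁ ⟩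
    a * ∣ q ∣       ≤⟨ ℚ.*-monoˡ-≤-nonNeg a {{ℚ.nonNegative (ℚ.≤-trans (ℚ.0≤∣p∣ p) h₁)}} h₂ ⟩
    a * b           ∎

  inv : ∀ {p} → 0ℚ < p → ℚ
  inv {p} p>0 = (ℚ.1/ p) {{ℚ.>-nonZero p>0}}

  inv>0 : ∀ {p} (p>0 : 0ℚ < p) → 0ℚ < inv p>0
  inv>0 {p} p>0 = ℚ.positive⁻¹ _ {{ℚ.1/pos⇒pos p {{ℚ.positive p>0}}}}

  *-inv : ∀ {p} (p>0 : 0ℚ < p) → p * inv p>0 ≡ 1ℚ
  *-inv {p} p>0 = ℚ.*-inverseʳ p {{ℚ.>-nonZero p>0}}

  *>0 : ∀ {p q} → 0ℚ < p → 0ℚ < q → 0ℚ < p * q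
  *>0 {p} {q} h₁ h₂ = ℚ.positive⁻¹ _ {{ℚ.pos*pos⇒pos p {{ℚ.positive h₁}} q {{ℚ.positive h₂}}}}

open RationalLemmas

-- ℝ is the setoid of Cauchy sequences of rationals, where two sequences
-- are identified when their difference tends to 0.
IsCauchy : (ℕ → ℚ) → Set
IsCauchy x = ∀ ε → 0ℚ ℚ.< ε →
  ∃[ N ] ∀ m n → N ℕ.≤ m → N ℕ.≤ n → ℚ.∣ x m ℚ.- x n ∣ ℚ.< ε

record ℝ : Set where
  constructor mkℝ
  field
    seq    : ℕ → ℚ
    cauchy : IsCauchy seq

open ℝ public

infix 4 _≈ℝ_

_≈ℝ_ : Rel ℝ 0ℓ
x ≈ℝ y = ∀ ε → 0ℚ ℚ.< ε →
  ∃[ N ] ∀ n → N ℕ.≤ n → ℚ.∣ seq x n ℚ.- seq y n ∣ ℚ.< ε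

ApartFrom0 : ℝ → Set
ApartFrom0 x = ∃[ c ] 0ℚ ℚ.< c × ∃[ N ] ∀ n → N ℕ.≤ n → c ℚ.≤ ℚ.∣ seq x n ∣

fromℚ : ℚ → ℝ
fromℚ q = mkℝ (λ _ → q) λ ε ε>0 → 0 , λ _ _ _ _ →
  subst (ℚ._< ε) (sym (cong ℚ.∣_∣ (ℚ.+-inverseʳ q))) ε>0

fromℕ : ℕ → ℝ
fromℕ n = fromℚ (+ n / 1)

infixl 6 _+ℝ_
infixl 7 _*ℝ_
infix  8 -ℝ_
infix  9 _⁻¹

_+ℝ_ : ℝ → ℝ → ℝ
mkℝ x cx +ℝ mkℝ y cy = mkℝ (λ n → x n ℚ.+ y n) λ ε ε>0 →
  let Nx , hx = cx (ℚ.½ ℚ.* ε) (½* ε>0)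
      Ny , hy = cy (ℚ.½ ℚ.* ε) (½* ε>0)
  in Nx ℕ.⊔ Ny , λ m n Nm Nn → begin-strict
    ∣ (x m + y m) - (x n + y n) ∣
      ≡⟨ cong ∣_∣ (solve 4 (λ a b c d → (a :+ b) :- (c :+ d) := (a :- c) :+ (b :- d)) refl
                   (x m) (y m) (x n) (y n)) ⟩
    ∣ (x m - x n) + (y m - y n) ∣
      ≤⟨ ℚ.∣p+q∣≤∣p∣+∣q∣ (x m - x n) (y m - y n) ⟩
    ∣ x m - x n ∣ + ∣ y m - y n ∣
      <⟨ ℚ.+-mono-< (hx m n (ℕ.m⊔n≤o⇒m≤o Nx Ny Nm) (ℕ.m⊔n≤o⇒m≤o Nx Ny Nn))
                    (hy m n (ℕ.m⊔n≤o⇒n≤o Nx Ny Nm) (ℕ.m⊔n≤o⇒n≤o Nx Ny Nn)) ⟩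
    ½ * ε + ½ * ε
      ≡⟨ halves ε ⟩
    ε ∎
  where
  open import Data.Rational.Base using (∣_∣; _+_; _-_; _*_; ½)
  open ℚ.≤-Reasoning
  open +-*-Solver using (solve; _:=_; _:+_; _:-_)

-ℝ_ : ℝ → ℝ
-ℝ mkℝ x cx = mkℝ (λ n → ℚ.- x n) λ ε ε>0 →
  let N , h = cx ε ε>0
  in N , λ m n Nm Nn →
    subst (λ t → ℚ.∣ t ∣ ℚ.< ε)
      (solve 2 (λ a b → b :- a := (:- a) :- (:- b)) refl (x m) (x n))
      (h n m Nn Nm)
  where open +-*-Solver using (solve; _:=_; _:-_; :-_)

∣_∣ℝ : ℝ → ℝ
∣ mkℝ x cx ∣ℝ = mkℝ (λ n → ℚ.∣ x n ∣) λ ε ε>0 →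
  let N , h = cx ε ε>0
  in N , λ m n Nm Nn → ∣∣p∣-∣q∣∣≤∣p-q∣ (x m) (x n) (h m n Nm Nn)

eventuallyBounded : ∀ {x} → IsCauchy x →
  ∃[ B ] 0ℚ ℚ.< B × ∃[ N ] ∀ n → N ℕ.≤ n → ℚ.∣ x n ∣ ℚ.≤ B
eventuallyBounded {x} cx =
  let N , h = cx 1ℚ 0<1
  in ∣ x N ∣ + 1ℚ
   , ℚ.≤-<-trans (ℚ.0≤∣p∣ (x N))
       (subst (ℚ._< ∣ x N ∣ + 1ℚ) (ℚ.+-identityʳ ∣ x N ∣) (ℚ.+-monoʳ-< ∣ x N ∣ 0<1))
   , N , λ n Nn → ℚ.≤-trans (∣p∣-∣q∣≤∣p-q∣ (x n) (x N))
       (ℚ.+-monoʳ-≤ ∣ x N ∣ (ℚ.<⇒≤ (h n N Nn ℕ.≤-refl)))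
  where
  open import Data.Rational.Base using (∣_∣; _+_)
  0<1 : 0ℚ ℚ.< 1ℚ
  0<1 = ℚ.positive⁻¹ 1ℚ

_*ℝ_ : ℝ → ℝ → ℝ
mkℝ x cx *ℝ mkℝ y cy = mkℝ (λ n → x n ℚ.* y n) λ ε ε>0 →
  let A , A>0 , Na , ha = eventuallyBounded cx
      B , B>0 , Nb , hb = eventuallyBounded cy
      AB>0 = ℚ.+-mono-< A>0 B>0
      δ = inv AB>0 * ε
      δ>0 = *>0 (inv>0 AB>0) ε>0
      Nx , hx = cx δ δ>0
      Ny , hy = cy δ δ>0
      bnds = Na ℕ.⊔ Nb
      mods = Nx ℕ.⊔ Ny
  in bnds ℕ.⊔ mods , λ m n Nm Nn →
    let open ℚ.≤-Reasoning
        am = ha m (ℕ.m⊔n≤o⇒m≤o Na Nb (ℕ.m⊔n≤o⇒m≤o bnds mods Nm))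
        bn = hb n (ℕ.m⊔n≤o⇒n≤o Na Nb (ℕ.m⊔n≤o⇒m≤o bnds mods Nn))
        M = ℕ.m⊔n≤o⇒n≤o bnds mods Nm
        N = ℕ.m⊔n≤o⇒n≤o bnds mods Nn
        dx = hx m n (ℕ.m⊔n≤o⇒m≤o Nx Ny M) (ℕ.m⊔n≤o⇒m≤o Nx Ny N)
        dy = hy m n (ℕ.m⊔n≤o⇒n≤o Nx Ny M) (ℕ.m⊔n≤o⇒n≤o Nx Ny N)
    in begin-strict
      ∣ x m * y m - x n * y n ∣
        ≡⟨ cong ∣_∣ (solve 4 (λ a b c d → a :* b :- c :* d := a :* (b :- d) :+ d :* (a :- c)) refl
                     (x m) (y m) (x n) (y n)) ⟩
      ∣ x m * (y m - y n) + y n * (x m - x n) ∣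
        ≤⟨ ℚ.∣p+q∣≤∣p∣+∣q∣ (x m * (y m - y n)) (y n * (x m - x n)) ⟩
      ∣ x m * (y m - y n) ∣ + ∣ y n * (x m - x n) ∣
        ≤⟨ ℚ.+-mono-≤ (∣*∣-mono (x m) (y m - y n) am ℚ.≤-refl)
                      (∣*∣-mono (y n) (x m - x n) bn ℚ.≤-refl) ⟩
      A * ∣ y m - y n ∣ + B * ∣ x m - x n ∣
        <⟨ ℚ.+-mono-< (ℚ.*-monoʳ-<-pos A {{ℚ.positive A>0}} dy)
                      (ℚ.*-monoʳ-<-pos B {{ℚ.positive B>0}} dx) ⟩
      A * δ + B * δ
        ≡⟨ solve 4 (λ a b i e → a :* (i :* e) :+ b :* (i :* e) := ((a :+ b) :* i) :* e) refl
             A B (inv AB>0) ε ⟩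
      ((A + B) * inv AB>0) * ε
        ≡⟨ cong (_* ε) (*-inv AB>0) ⟩
      1ℚ * ε
        ≡⟨ ℚ.*-identityˡ ε ⟩
      ε ∎
  where
  open import Data.Rational.Base using (∣_∣; _+_; _-_; _*_)
  open +-*-Solver using (solve; _:=_; _:+_; _:*_; _:-_)

-- The reciprocal, with the junk value 0 at 0.
1/₀_ : ℚ → ℚ
1/₀ p with p ℚ.≟ 0ℚ
... | yes _  = 0ℚ
... | no p≢0 = (ℚ.1/ p) {{ℚ.≢-nonZero p≢0}}

apart⇒≢0 : ∀ {c p} → 0ℚ ℚ.< c → c ℚ.≤ ℚ.∣ p ∣ → p ≢ 0ℚ
apart⇒≢0 c>0 c≤ refl = ℚ.<-irrefl refl (ℚ.<-≤-trans c>0 c≤)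

*-1/₀ : ∀ {p} → p ≢ 0ℚ → p ℚ.* 1/₀ p ≡ 1ℚ
*-1/₀ {p} p≢0 with p ℚ.≟ 0ℚ
... | yes e = contradiction e p≢0
... | no ne = ℚ.*-inverseʳ p {{ℚ.≢-nonZero ne}}

∣1/₀∣≤ : ∀ {c p} (c>0 : 0ℚ ℚ.< c) → c ℚ.≤ ℚ.∣ p ∣ → ℚ.∣ 1/₀ p ∣ ℚ.≤ inv c>0
∣1/₀∣≤ {c} {p} c>0 c≤ = begin
  ∣ r ∣                   ≡⟨ ℚ.*-identityʳ ∣ r ∣ ⟨
  ∣ r ∣ * 1ℚ              ≡⟨ cong (∣ r ∣ *_) (*-inv c>0) ⟨
  ∣ r ∣ * (c * i)         ≡⟨ ℚ.*-assoc ∣ r ∣ c i ⟨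
  ∣ r ∣ * c * i           ≤⟨ ℚ.*-monoʳ-≤-nonNeg i {{ℚ.nonNegative (ℚ.<⇒≤ (inv>0 c>0))}}
                               (ℚ.*-monoˡ-≤-nonNeg ∣ r ∣ {{ℚ.∣-∣-nonNeg r}} c≤) ⟩
  ∣ r ∣ * ∣ p ∣ * i       ≡⟨ cong (_* i) (ℚ.∣p*q∣≡∣p∣*∣q∣ r p) ⟨
  ∣ r * p ∣ * i           ≡⟨ cong (λ t → ∣ t ∣ * i) (trans (ℚ.*-comm r p) (*-1/₀ (apart⇒≢0 c>0 c≤))) ⟩
  1ℚ * i                  ≡⟨ ℚ.*-identityˡ i ⟩
  i                       ∎
  where
  open import Data.Rational.Base using (∣_∣; _*_)
  open ℚ.≤-Reasoning
  r = 1/₀ p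
  i = inv c>0

_⁻¹ : (x : ℝ) → {ApartFrom0 x} → ℝ
_⁻¹ (mkℝ x cx) {c , c>0 , N₀ , hc} = mkℝ (λ n → 1/₀ x n) λ ε ε>0 →
  let N , h = cx (c * c * ε) (*>0 (*>0 c>0 c>0) ε>0)
  in N₀ ℕ.⊔ N , λ m n Nm Nn →
    let open ℚ.≤-Reasoning
        cm = hc m (ℕ.m⊔n≤o⇒m≤o N₀ N Nm)
        cn = hc n (ℕ.m⊔n≤o⇒m≤o N₀ N Nn)
        d = h n m (ℕ.m⊔n≤o⇒n≤o N₀ N Nn) (ℕ.m⊔n≤o⇒n≤o N₀ N Nm)
        r = 1/₀ x m
        s = 1/₀ x n
        i = inv c>0
    in begin-strict
      ∣ r - s ∣
        ≡⟨ cong ∣_∣ (cong₂ _-_ (ℚ.*-identityʳ r) (ℚ.*-identityʳ s)) ⟨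
      ∣ r * 1ℚ - s * 1ℚ ∣
        ≡⟨ cong₂ (λ a b → ∣ r * a - s * b ∣) (*-1/₀ (apart⇒≢0 c>0 cn)) (*-1/₀ (apart⇒≢0 c>0 cm)) ⟨
      ∣ r * (x n * s) - s * (x m * r) ∣
        ≡⟨ cong ∣_∣ (solve 4 (λ r s a b → r :* (b :* s) :- s :* (a :* r) := (r :* s) :* (b :- a))
                     refl r s (x m) (x n)) ⟩
      ∣ (r * s) * (x n - x m) ∣
        ≤⟨ ∣*∣-mono (r * s) (x n - x m)
             (∣*∣-mono r s (∣1/₀∣≤ c>0 cm) (∣1/₀∣≤ c>0 cn)) ℚ.≤-refl ⟩
      (i * i) * ∣ x n - x m ∣
        <⟨ ℚ.*-monoʳ-<-pos (i * i) {{ℚ.positive (*>0 (inv>0 c>0) (inv>0 c>0))}} d ⟩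
      (i * i) * (c * c * ε)
        ≡⟨ solve 3 (λ i c e → (i :* i) :* (c :* c :* e) := (c :* i) :* ((c :* i) :* e)) refl i c ε ⟩
      (c * i) * ((c * i) * ε)
        ≡⟨ cong (λ t → t * (t * ε)) (*-inv c>0) ⟩
      1ℚ * (1ℚ * ε)
        ≡⟨ trans (ℚ.*-identityˡ _) (ℚ.*-identityˡ ε) ⟩
      ε ∎
  where
  open import Data.Rational.Base using (∣_∣; _-_; _*_)
  open +-*-Solver using (solve; _:=_; _:*_; _:-_)

ℝ-rawRing : RawRing 0ℓ 0ℓ
ℝ-rawRing = record
  { Carrier = ℝ
  ; _≈_     = _≈ℝ_
  ; _+_     = _+ℝ_
  ; _*_     = _*ℝ_
  ; -_      = -ℝ_
  ; 0#      = fromℚ 0ℚ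
  ; 1#      = fromℚ 1ℚ
  }

-- If r = ⌊√ n ⌋, then √-step r (suc n) = ⌊√ suc n ⌋.
√-step : ℕ → ℕ → ℕ
√-step r n with suc r ℕ.* suc r ℕ.≤? n
... | yes _ = suc r
... | no _  = r

⌊√_⌋ : ℕ → ℕ
⌊√ zero ⌋ = 0
⌊√ suc n ⌋ = √-step ⌊√ n ⌋ (suc n)

⌊√⌋-lower : ∀ n → ⌊√ n ⌋ ℕ.* ⌊√ n ⌋ ℕ.≤ n
⌊√⌋-lower zero = z≤n
⌊√⌋-lower (suc n) with suc ⌊√ n ⌋ ℕ.* suc ⌊√ n ⌋ ℕ.≤? suc n
... | yes p = p
... | no _  = ℕ.m≤n⇒m≤1+n (⌊√⌋-lower n)

⌊√⌋-upper : ∀ n → n ℕ.< suc ⌊√ n ⌋ ℕ.* suc ⌊√ n ⌋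
⌊√⌋-upper zero = s≤s z≤n
⌊√⌋-upper (suc n) with suc ⌊√ n ⌋ ℕ.* suc ⌊√ n ⌋ ℕ.≤? suc n
... | yes _ = ℕ.<-≤-trans (s≤s (⌊√⌋-upper n))
                (ℕ.*-mono-< {suc ⌊√ n ⌋} (ℕ.n<1+n _) (ℕ.n<1+n _))
... | no ¬p = ℕ.≰⇒> ¬p

sqrtNum : ℕ → ℕ → ℕ
sqrtNum d n = ⌊√ d ℕ.* (suc n ℕ.* suc n) ⌋

-- The largest multiple of 1/(n+1) that is at most √d.
√-approx : ℕ → ℕ → ℚ
√-approx d n = + sqrtNum d n / suc n

square-cancel-< : ∀ {a b} → a ℕ.* a ℕ.< b ℕ.* b → a ℕ.< b
square-cancel-< {a} {b} h =
  ℕ.≰⇒> (λ b≤a → ℕ.<-irrefl refl (ℕ.<-≤-trans h (ℕ.*-mono-≤ b≤a b≤a)))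

sqrtNum-< : ∀ d m n → sqrtNum d m ℕ.* suc n ℕ.< suc (sqrtNum d n) ℕ.* suc m
sqrtNum-< d m n = square-cancel-< (begin-strict
  (r ℕ.* suc n) ℕ.* (r ℕ.* suc n)                 ≡⟨ swap r (suc n) ⟩
  (r ℕ.* r) ℕ.* (suc n ℕ.* suc n)                 ≤⟨ ℕ.*-monoˡ-≤ (suc n ℕ.* suc n) (⌊√⌋-lower (d ℕ.* (suc m ℕ.* suc m))) ⟩
  d ℕ.* (suc m ℕ.* suc m) ℕ.* (suc n ℕ.* suc n)   ≡⟨ swap′ d (suc m ℕ.* suc m) (suc n ℕ.* suc n) ⟩
  d ℕ.* (suc n ℕ.* suc n) ℕ.* (suc m ℕ.* suc m)   <⟨ ℕ.*-monoˡ-< (suc m ℕ.* suc m) (⌊√⌋-upper (d ℕ.* (suc n ℕ.* suc n))) ⟩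
  (s ℕ.* s) ℕ.* (suc m ℕ.* suc m)                 ≡⟨ swap s (suc m) ⟨
  (s ℕ.* suc m) ℕ.* (s ℕ.* suc m)                 ∎)
  where
  open ℕ.≤-Reasoning
  r = sqrtNum d m
  s = suc (sqrtNum d n)
  swap : ∀ a b → (a ℕ.* b) ℕ.* (a ℕ.* b) ≡ (a ℕ.* a) ℕ.* (b ℕ.* b)
  swap = solve-∀
  swap′ : ∀ a b c → a ℕ.* b ℕ.* c ≡ a ℕ.* c ℕ.* b
  swap′ = solve-∀

/-mono-< : ∀ a m b n → a ℕ.* suc n ℕ.< b ℕ.* suc m → + a / suc m ℚ.< + b / suc n
/-mono-< a m b n h = ℚ.toℚᵘ-cancel-<
  (ℚᵘ.<-respˡ-≃ (ℚᵘ.≃-sym (ℚ.toℚᵘ-fromℚᵘ (mkℚᵘ (+ a) m)))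
    (ℚᵘ.<-respʳ-≃ (ℚᵘ.≃-sym (ℚ.toℚᵘ-fromℚᵘ (mkℚᵘ (+ b) n)))
      (*<* (subst₂ ℤ._<_ (ℤ.pos-* a (suc n)) (ℤ.pos-* b (suc m)) (ℤ.+<+ h)))))

/-mono-≤ : ∀ a m b n → a ℕ.* suc n ℕ.≤ b ℕ.* suc m → + a / suc m ℚ.≤ + b / suc n
/-mono-≤ a m b n h = ℚ.toℚᵘ-cancel-≤
  (ℚᵘ.≤-respˡ-≃ (ℚᵘ.≃-sym (ℚ.toℚᵘ-fromℚᵘ (mkℚᵘ (+ a) m)))
    (ℚᵘ.≤-respʳ-≃ (ℚᵘ.≃-sym (ℚ.toℚᵘ-fromℚᵘ (mkℚᵘ (+ b) n)))
      (*≤* (subst₂ ℤ._≤_ (ℤ.pos-* a (suc n)) (ℤ.pos-* b (suc m)) (ℤ.+≤+ h)))))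

suc-/ : ∀ a n → + suc a / suc n ≡ (+ a / suc n) ℚ.+ (+ 1 / suc n)
suc-/ a n = ℚ.toℚᵘ-injective (begin
  toℚᵘ (+ suc a / suc n)                        ≈⟨ ℚ.toℚᵘ-fromℚᵘ (mkℚᵘ (+ suc a) n) ⟩
  mkℚᵘ (+ suc a) n                              ≈⟨ *≡* (eq (+ a) (+ suc n)) ⟩
  mkℚᵘ (+ a) n ℚᵘ.+ mkℚᵘ (+ 1) n                ≈⟨ ℚᵘ.+-cong (ℚ.toℚᵘ-fromℚᵘ (mkℚᵘ (+ a) n)) (ℚ.toℚᵘ-fromℚᵘ (mkℚᵘ (+ 1) n)) ⟨
  toℚᵘ (+ a / suc n) ℚᵘ.+ toℚᵘ (+ 1 / suc n)    ≈⟨ ℚ.toℚᵘ-homo-+ (+ a / suc n) (+ 1 / suc n) ⟨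
  toℚᵘ ((+ a / suc n) ℚ.+ (+ 1 / suc n))        ∎)
  where
  open ℚᵘ.≃-Reasoning
  eq : ∀ a s → (+ 1 ℤ.+ a) ℤ.* (s ℤ.* s) ≡ (a ℤ.* s ℤ.+ + 1 ℤ.* s) ℤ.* s
  eq = ℤSolver.solve-∀

1/-≤ : ∀ {ε} → 0ℚ ℚ.< ε → ∃[ N ] ∀ n → N ℕ.≤ n → + 1 / suc n ℚ.≤ ε
1/-≤ {mkℚ (+ zero) k c} (ℚ.*<* (ℤ.+<+ ()))
1/-≤ {ε@(mkℚ +[1+ a ] k c)} _ = k , λ n k≤n →
  subst (+ 1 / suc n ℚ.≤_) (ℚ.↥p/↧p≡p ε)
    (/-mono-≤ 1 n (suc a) k (ℕ.*-mono-≤ {1} {suc a} (s≤s z≤n) (s≤s k≤n)))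
1/-≤ {mkℚ -[1+ a ] k c} (ℚ.*<* ())

√ : ℕ → ℝ
√ d = mkℝ (√-approx d) λ ε ε>0 →
  let N , h = 1/-≤ ε>0
      close : ∀ m n → N ℕ.≤ n → √-approx d m ℚ.- √-approx d n ℚ.< ε
      close m n Nn = p<q+r⇒p-q<r (√-approx d m) (√-approx d n) ε
        (ℚ.<-≤-trans
          (subst (√-approx d m ℚ.<_) (suc-/ (sqrtNum d n) n)
            (/-mono-< (sqrtNum d m) m (suc (sqrtNum d n)) n (sqrtNum-< d m n)))
          (ℚ.+-monoʳ-≤ (√-approx d n) (h n Nn)))
  in N , λ m n Nm Nn → ∣∣-< _ ε (close m n Nn)
       (subst (ℚ._< ε)
         (solve 2 (λ a b → b :- a := :- (a :- b)) refl (√-approx d m) (√-approx d n))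
         (close n m Nm))
  where open +-*-Solver using (solve; _:=_; _:-_; :-_)

√-apart : ∀ d .{{_ : ℕ.NonZero d}} → ApartFrom0 (√ d)
√-apart d@(suc d-1) = 1ℚ , ℚ.positive⁻¹ 1ℚ , 0 , λ n _ →
  ℚ.≤-trans
    (/-mono-≤ 1 0 (sqrtNum d n) n
      (subst₂ ℕ._≤_ (sym (ℕ.*-identityˡ (suc n))) (sym (ℕ.*-identityʳ (sqrtNum d n)))
        (ℕ.≤-pred (square-cancel-< (ℕ.≤-<-trans
          (ℕ.m≤m+n (suc n ℕ.* suc n) (d-1 ℕ.* (suc n ℕ.* suc n)))
          (⌊√⌋-upper (d ℕ.* (suc n ℕ.* suc n))))))))
    (p≤∣p∣ (√-approx d n))

1/√ : (d : ℕ) .{{_ : ℕ.NonZero d}} → ℝ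
1/√ d = (√ d ⁻¹) {√-apart d}

-- Univariate polynomials, as coefficient lists with the constant
-- coefficient first; trailing zeros are allowed

module Polynomial {c ℓ} (R : RawRing c ℓ) where
  private module R = RawRing R

  Poly : Set c
  Poly = List R.Carrier

  coeff : Poly → ℕ → R.Carrier
  coeff []      _       = R.0#
  coeff (a ∷ p) zero    = a
  coeff (a ∷ p) (suc k) = coeff p k

  add : Poly → Poly → Poly
  add []      q       = q
  add (a ∷ p) []      = a ∷ p
  add (a ∷ p) (b ∷ q) = a R.+ b ∷ add p q

  mul : Poly → Poly → Poly
  mul []      q = []
  mul (a ∷ p) q = add (map (a R.*_) q) (R.0# ∷ mul p q)

  rawRing : RawRing c ℓ
  rawRing = record
    { Carrier = Poly
    ; _≈_     = λ p q → ∀ k → coeff p k R.≈ coeff q k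
    ; _+_     = add
    ; _*_     = mul
    ; -_      = map R.-_
    ; 0#      = []
    ; 1#      = R.1# ∷ []
    }

  open RawRing rawRing public hiding (Carrier)
  open RawSemiringDefinitions (RawRing.rawSemiring rawRing) public using (_^_; product)

  infixl 6 _-_
  _-_ : Poly → Poly → Poly
  p - q = p + (- q)

  C : R.Carrier → Poly
  C a = a ∷ []

  X : Poly
  X = R.0# ∷ R.1# ∷ []

Matrix : ∀ {c} → Set c → ℕ → Set c
Matrix A N = Fin N → Fin N → A

module Determinant {c ℓ} (R : RawRing c ℓ) where
  open RawRing R
  open RawSemiringDefinitions rawSemiring using (sum; _^_)

  minor : ∀ {N} → Matrix Carrier (suc N) → Fin (suc N) → Matrix Carrier N
  minor M j i k = M (suc i) (punchIn j k)

  -- Laplace expansion along the first row.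
  det : ∀ {N} → Matrix Carrier N → Carrier
  det {zero}  M = 1#
  det {suc N} M = sum (λ j → (- 1#) ^ toℕ j * M zero j * det (minor M j))

module ℝ[X] = Polynomial ℝ-rawRing

charMatrix : ∀ {N} → Matrix ℝ N → Matrix ℝ[X].Poly N
charMatrix M i j with i Fin.≟ j
... | yes _ = ℝ[X].X ℝ[X].- ℝ[X].C (M i j)
... | no _  = ℝ[X].- ℝ[X].C (M i j)

charPoly : ∀ {N} → Matrix ℝ N → ℝ[X].Poly
charPoly M = Determinant.det ℝ[X].rawRing (charMatrix M)

-- ρ lists the eigenvalues of M with (algebraic) multiplicity.
IsSpectrum : ∀ {N} → Matrix ℝ N → Vector ℝ N → Set
IsSpectrum M ρ = charPoly M ≈ product (λ i → X - C (ρ i))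
  where open ℝ[X]

record Graph : Set₁ where
  field
    order  : ℕ
    _~_    : Rel (Fin order) 0ℓ
    _~?_   : Decidable _~_
    sym-~  : Symmetric _~_
    irrefl : Irreflexive _≡_ _~_

  neighbours : Fin order → List (Fin order)
  neighbours u = filter (u ~?_) (allFin order)

  degree : Fin order → ℕ
  degree u = length (neighbours u)

  degree-nonZero : ∀ {u v} → u ~ v → ℕ.NonZero (degree u)
  degree-nonZero {u} {v} u~v = nonEmpty (∈-filter⁺ (u ~?_) (∈-allFin v) u~v)
    where
    nonEmpty : ∀ {vs} → v ∈ vs → ℕ.NonZero (length vs)
    nonEmpty {_ ∷ _} _ = _

  randićMatrix : Matrix ℝ order
  randićMatrix u v with u ~? v
  ... | yes u~v = 1/√ (degree u ℕ.* degree v)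
                    {{ℕ.m*n≢0 _ _ {{degree-nonZero u~v}} {{degree-nonZero (sym-~ u~v)}}}}
  ... | no _    = fromℚ 0ℚ

RP : Graph → ℝ[X].Poly
RP G = charPoly (Graph.randićMatrix G)

-- The energy is a relation because the eigenvalues are not computed from
-- the matrix: some list of them has to exist, and every such list must
-- give the value e.
HasRE : Graph → ℝ → Set
HasRE G e = ∃ (IsSpectrum randićMatrix)
          × (∀ ρ → IsSpectrum randićMatrix ρ → sum (λ i → ∣ ρ i ∣ℝ) ≈ℝ e)
  where
  open Graph G
  open RawSemiringDefinitions (RawRing.rawSemiring ℝ-rawRing) using (sum)

module Friendship (n : ℕ) where

  -- Vertex 0 is the common vertex of the triangles; the other two vertices
  -- of the i-th triangle are the suc k with quotient 2 k ≡ i.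
  Vertex : Set
  Vertex = Fin (suc (n ℕ.* 2))

  triangle : Fin (n ℕ.* 2) → Fin n
  triangle = quotient 2

  Adj : Rel Vertex 0ℓ
  Adj zero    zero    = ⊥
  Adj zero    (suc _) = ⊤
  Adj (suc _) zero    = ⊤
  Adj (suc k) (suc l) = k ≢ l × triangle k ≡ triangle l

  adj? : Decidable Adj
  adj? zero    zero    = no λ ()
  adj? zero    (suc _) = yes tt
  adj? (suc _) zero    = yes tt
  adj? (suc k) (suc l) = ¬? (k Fin.≟ l) ×-dec (triangle k Fin.≟ triangle l)

  adj-sym : Symmetric Adj
  adj-sym {zero}  {suc _} _         = tt
  adj-sym {suc _} {zero}  _         = tt
  adj-sym {suc _} {suc _} (k≢l , e) = ≢-sym k≢l , sym e

  adj-irrefl : Irreflexive _≡_ Adj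
  adj-irrefl {zero}  refl ()
  adj-irrefl {suc _} refl (k≢k , _) = k≢k refl

friendship : ℕ → Graph
friendship n = record
  { order  = suc (n ℕ.* 2)
  ; _~_    = Adj
  ; _~?_   = adj?
  ; sym-~  = λ {u} {v} → adj-sym {u} {v}
  ; irrefl = λ {u} {v} → adj-irrefl {u} {v}
  }
  where open Friendship n

-- The Laplace expansion of the bordered block matrix λI − R(Fₙ) along the
-- row of the common vertex never leaves a family of matrices closed under
-- minors: deleting that row and the column of a vertex of one triangle
-- leaves a matrix in which every other triangle splits off a factor
-- Δ = λ² − 1/4.  This gives det = λ Δⁿ − 2n a² (λ + 1/2) Δⁿ⁻¹ with
-- a² = 1/(4n), which factors as claimed.
--
-- For the energy, any list of eigenvalues has to be compared with the
-- expected one.  Each ρ₀ is a root of ∏ (X − σⱼ), so it equals some σⱼ, the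
-- two linear factors cancel, and one proceeds by induction.  Which σⱼ it is
-- cannot be decided constructively, but equality of reals is stable under
-- double negation, so that choice may be made classically.
module Submission where

open import Data.Integer.Base using (+_)
open import Data.Nat.Base as ℕ using (ℕ; _≥_; _∸_)
open import Data.Product.Base using (_×_)
open import Data.Rational.Base using (1ℚ; ½; _/_)
open import Defs

open import Algebra.Bundles using (CommutativeRing; RawRing)
import Algebra.Definitions.RawSemiring as RawSemiringDefinitions
open import Algebra.Morphism.Structures using (module RingMorphisms)
import Algebra.Solver.Ring as RingSolver
open import Algebra.Solver.Ring.AlmostCommutativeRing using (fromCommutativeRing; _-Raw-AlmostCommutative⟶_)
open import Algebra.Structures using (IsCommutativeRing)
open import Data.Fin.Base using (Fin; zero; suc; toℕ; punchIn; quotient)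
import Data.Fin.Properties as Fin
import Data.Integer.Base as ℤ
import Data.Integer.Properties as ℤ
open import Data.List.Base using ([]; _∷_; length; map; filter; tabulate; allFin)
open import Data.List.Properties using (filter-none; filter-all; length-tabulate)
open import Data.List.Relation.Unary.All.Properties using (tabulate⁺)
import Data.Maybe.Base as Maybe
open import Data.Nat.Base using (zero; suc; z≤n; s≤s)
import Data.Nat.Properties as ℕ
open import Data.Nat.Tactic.RingSolver using (solve-∀)
open import Data.Product.Base using (∃-syntax; _,_)
open import Data.Rational.Base as ℚ using (ℚ; 0ℚ; -½; toℚᵘ)
import Data.Rational.Properties as ℚ
open import Data.Rational.Solver using (module +-*-Solver)
open import Data.Rational.Unnormalised.Base using (mkℚᵘ; *≡*)
import Data.Rational.Unnormalised.Base as ℚᵘ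
import Data.Rational.Unnormalised.Properties as ℚᵘ
open import Data.Sum.Base using (_⊎_; inj₁; inj₂)
open import Data.Vec.Functional using (Vector; removeAt; tail)
open import Function.Base using (_∘_)
open import Level using (_⊔_)
open import Relation.Binary.PropositionalEquality as ≡ using (_≡_; _≢_)
open import Relation.Nullary using (¬_; yes; no; ¬?)
open import Relation.Nullary.Decidable using (_×-dec_; dec⇒maybe)
open import Relation.Nullary.Negation using (contradiction)
open import Relation.Unary using (Pred; Decidable)

open RingMorphisms using (IsRingHomomorphism)

-- Polynomials over a commutative ring

-- The border entry of the matrix, the reciprocal of the square root of 4n, is the one entry that
-- may be irrational, and the determinant contains it only squared. All 2n outer vertices contribute
-- the same cofactor term, so the square occurs multiplied by 2n and amounts to 1/2. This is why n
-- disappears from the eigenvalues and the spectrum is rational. The determinant can therefore be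
-- computed over any commutative ring that receives a homomorphism from ℚ; the reals only have to
-- supply the entries.
--
-- The energy needs the reals to behave like an integral domain although their equality cannot be
-- decided. Both requirements come from apartness: a real equals 0 exactly when it is not apart from
-- 0, which makes equality a negated and hence stable statement, and a product of reals apart from 0
-- is apart from 0, which gives a doubly negated zero-product law. Cancelling a linear factor rests
-- on monicity alone.

IsCommutative : ∀ {c ℓ} → RawRing c ℓ → Set (c ⊔ ℓ)
IsCommutative raw = IsCommutativeRing _≈_ _+_ _*_ -_ 0# 1#
  where open RawRing raw

fromRaw : ∀ {c ℓ} (raw : RawRing c ℓ) → IsCommutative raw → CommutativeRing c ℓ
fromRaw raw isCR = record { isCommutativeRing = isCR }

module _ {c ℓ} (raw : RawRing c ℓ) (isCR : IsCommutative raw) where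
  open RawRing raw using (_≈_; _*_; 1#)
  open CommutativeRing (fromRaw raw isCR) using (setoid; *-commutativeSemigroup; *-congˡ; *-cong; *-comm; *-identityˡ)
  open import Relation.Binary.Reasoning.Setoid setoid
  open import Algebra.Properties.CommutativeSemigroup *-commutativeSemigroup using (interchange)

  -- With `s` a square root of `d`, the left side is the square of `s * r`. This makes the square of
  -- `1/√ d` rational.
  reciprocal-square : ∀ s r d → s * s ≈ d → s * r ≈ 1# → r * r * d ≈ 1#
  reciprocal-square s r d s²≈d sr≈1 = begin
    r * r * d          ≈⟨ *-congˡ s²≈d ⟨
    r * r * (s * s)    ≈⟨ *-comm _ _ ⟩
    s * s * (r * r)    ≈⟨ interchange s s r r ⟩
    s * r * (s * r)    ≈⟨ *-cong sr≈1 sr≈1 ⟩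
    1# * 1#            ≈⟨ *-identityˡ 1# ⟩
    1#                 ∎

-- Stated over a raw ring so that the polynomials of an instance are
-- syntactically those of Polynomial raw: unifying two presentations of
-- ℝ[X] would unfold the Cauchy proofs in its coefficients.
module PolynomialProperties {c ℓ} (raw : RawRing c ℓ) (isCR : IsCommutative raw) where
  open RawRing raw using (Carrier; _≈_; _+_; _*_; -_; 0#; 1#)
  R : CommutativeRing c ℓ
  R = fromRaw raw isCR
  open CommutativeRing R hiding (zero; _-_; Carrier; _≈_; _+_; _*_; -_; 0#; 1#; rawRing)
  open import Algebra.Properties.Ring ring using (-‿distribˡ-*; -‿distribʳ-*; -‿involutive; -0#≈0#)
  open import Algebra.Properties.CommutativeSemigroup +-commutativeSemigroup using (interchange; x∙yz≈y∙xz)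
  open import Algebra.Properties.CommutativeSemigroup *-commutativeSemigroup using () renaming (x∙yz≈y∙xz to x*yz≈y*xz)
  open import Relation.Binary.Reasoning.Setoid setoid
  open RawSemiringDefinitions (RawRing.rawSemiring raw) using (product)
  private module P = Polynomial raw
  open P using (Poly; coeff; add; mul; C; X)

  scale : Carrier → Poly → Poly
  scale a = map (a *_)

  coeff-add : ∀ p q k → coeff (add p q) k ≈ coeff p k + coeff q k
  coeff-add []      q       k       = sym (+-identityˡ _)
  coeff-add (a ∷ p) []      k       = sym (+-identityʳ _)
  coeff-add (a ∷ p) (b ∷ q) zero    = refl
  coeff-add (a ∷ p) (b ∷ q) (suc k) = coeff-add p q k

  coeff-scale : ∀ a p k → coeff (scale a p) k ≈ a * coeff p k
  coeff-scale a []      k       = sym (zeroʳ a)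
  coeff-scale a (b ∷ p) zero    = refl
  coeff-scale a (b ∷ p) (suc k) = coeff-scale a p k

  coeff-neg : ∀ p k → coeff (map -_ p) k ≈ - coeff p k
  coeff-neg []      k       = sym -0#≈0#
  coeff-neg (b ∷ p) zero    = refl
  coeff-neg (b ∷ p) (suc k) = coeff-neg p k

  coeff-≥length : ∀ p k → length p ℕ.≤ k → coeff p k ≈ 0#
  coeff-≥length []      k       _           = refl
  coeff-≥length (a ∷ p) (suc k) (ℕ.s≤s l≤k) = coeff-≥length p k l≤k

  -- A record, unlike the function type P._≈_, lets p and q be inferred.
  infix 4 _≋_
  record _≋_ (p q : Poly) : Set ℓ where
    constructor coeffwise
    field at : ∀ k → coeff p k ≈ coeff q k
  open _≋_ public

  ≋-refl : ∀ {p} → p ≋ p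
  ≋-refl = coeffwise λ k → refl

  ≋-sym : ∀ {p q} → p ≋ q → q ≋ p
  ≋-sym p≋q = coeffwise λ k → sym (at p≋q k)

  ≋-trans : ∀ {p q r} → p ≋ q → q ≋ r → p ≋ r
  ≋-trans p≋q q≋r = coeffwise λ k → trans (at p≋q k) (at q≋r k)

  ≡⇒≋ : ∀ {p q} → p ≡.≡ q → p ≋ q
  ≡⇒≋ ≡.refl = ≋-refl

  ∷-cong : ∀ {a b p q} → a ≈ b → p ≋ q → a ∷ p ≋ b ∷ q
  ∷-cong a≈b p≋q .at zero    = a≈b
  ∷-cong a≈b p≋q .at (suc k) = at p≋q k

  0∷[]≋[] : 0# ∷ [] ≋ []
  0∷[]≋[] .at zero    = refl
  0∷[]≋[] .at (suc k) = refl

  add-cong : ∀ {p p′ q q′} → p ≋ p′ → q ≋ q′ → add p q ≋ add p′ q′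
  add-cong {p} {p′} {q} {q′} e f .at k = begin
    coeff (add p q) k        ≈⟨ coeff-add p q k ⟩
    coeff p k + coeff q k    ≈⟨ +-cong (at e k) (at f k) ⟩
    coeff p′ k + coeff q′ k  ≈⟨ coeff-add p′ q′ k ⟨
    coeff (add p′ q′) k      ∎

  add-assoc : ∀ p q r → add (add p q) r ≋ add p (add q r)
  add-assoc p q r .at k = begin
    coeff (add (add p q) r) k              ≈⟨ coeff-add (add p q) r k ⟩
    coeff (add p q) k + coeff r k          ≈⟨ +-congʳ (coeff-add p q k) ⟩
    coeff p k + coeff q k + coeff r k      ≈⟨ +-assoc _ _ _ ⟩
    coeff p k + (coeff q k + coeff r k)    ≈⟨ +-congˡ (coeff-add q r k) ⟨
    coeff p k + coeff (add q r) k          ≈⟨ coeff-add p (add q r) k ⟨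
    coeff (add p (add q r)) k              ∎

  add-comm : ∀ p q → add p q ≋ add q p
  add-comm p q .at k = trans (coeff-add p q k) (trans (+-comm _ _) (sym (coeff-add q p k)))

  add-identityʳ : ∀ p → add p [] ≋ p
  add-identityʳ []      = ≋-refl
  add-identityʳ (a ∷ p) = ≋-refl

  neg-cong : ∀ {p q} → p ≋ q → map -_ p ≋ map -_ q
  neg-cong {p} {q} e .at k =
    trans (coeff-neg p k) (trans (-‿cong (at e k)) (sym (coeff-neg q k)))

  add-inverseʳ : ∀ p → add p (map -_ p) ≋ []
  add-inverseʳ p .at k = trans (coeff-add p _ k)
    (trans (+-congˡ (coeff-neg p k)) (-‿inverseʳ _))

  scale-cong : ∀ {a b p q} → a ≈ b → p ≋ q → scale a p ≋ scale b q
  scale-cong {a} {b} {p} {q} e f .at k =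
    trans (coeff-scale a p k) (trans (*-cong e (at f k)) (sym (coeff-scale b q k)))

  scale-add : ∀ a p q → scale a (add p q) ≋ add (scale a p) (scale a q)
  scale-add a p q .at k = begin
    coeff (scale a (add p q)) k                  ≈⟨ coeff-scale a (add p q) k ⟩
    a * coeff (add p q) k                        ≈⟨ *-congˡ (coeff-add p q k) ⟩
    a * (coeff p k + coeff q k)                  ≈⟨ distribˡ _ _ _ ⟩
    a * coeff p k + a * coeff q k                ≈⟨ +-cong (coeff-scale a p k) (coeff-scale a q k) ⟨
    coeff (scale a p) k + coeff (scale a q) k    ≈⟨ coeff-add (scale a p) (scale a q) k ⟨
    coeff (add (scale a p) (scale a q)) k        ∎

  scale-scale : ∀ a b p → scale (a * b) p ≋ scale a (scale b p)
  scale-scale a b p .at k = begin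
    coeff (scale (a * b) p) k      ≈⟨ coeff-scale (a * b) p k ⟩
    a * b * coeff p k              ≈⟨ *-assoc _ _ _ ⟩
    a * (b * coeff p k)            ≈⟨ *-congˡ (coeff-scale b p k) ⟨
    a * coeff (scale b p) k        ≈⟨ coeff-scale a (scale b p) k ⟨
    coeff (scale a (scale b p)) k  ∎

  scale-0 : ∀ p → scale 0# p ≋ []
  scale-0 p .at k = trans (coeff-scale 0# p k) (zeroˡ _)

  scale-1 : ∀ p → scale 1# p ≋ p
  scale-1 p .at k = trans (coeff-scale 1# p k) (*-identityˡ _)

  mul-congˡ : ∀ p {q q′} → q ≋ q′ → mul p q ≋ mul p q′
  mul-congˡ []      e = ≋-refl
  mul-congˡ (a ∷ p) e = add-cong (scale-cong refl e) (∷-cong refl (mul-congˡ p e))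

  mul-zeroʳ : ∀ p → mul p [] ≋ []
  mul-zeroʳ []      = ≋-refl
  mul-zeroʳ (a ∷ p) = ≋-trans (∷-cong refl (mul-zeroʳ p)) 0∷[]≋[]

  add-x∙yz≈y∙xz : ∀ p q r → add p (add q r) ≋ add q (add p r)
  add-x∙yz≈y∙xz p q r = ≋-trans (≋-sym (add-assoc p q r))
    (≋-trans (add-cong (add-comm p q) ≋-refl) (add-assoc q p r))

  -- `mul` recurses on its left factor; this is the matching recursion on the right one, which turns
  -- commutativity into an induction.
  mul-∷ʳ : ∀ p b q → mul p (b ∷ q) ≋ add (scale b p) (0# ∷ mul p q)
  mul-∷ʳ []      b q = ≋-sym 0∷[]≋[]
  mul-∷ʳ (a ∷ p) b q = ∷-cong (+-congʳ (*-comm a b))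
    (≋-trans (add-cong ≋-refl (mul-∷ʳ p b q))
             (add-x∙yz≈y∙xz (scale a q) (scale b p) (0# ∷ mul p q)))

  mul-comm : ∀ p q → mul p q ≋ mul q p
  mul-comm []      q = ≋-sym (mul-zeroʳ q)
  mul-comm (a ∷ p) q = ≋-trans (add-cong ≋-refl (∷-cong refl (mul-comm p q)))
    (≋-sym (mul-∷ʳ q a p))

  mul-cong : ∀ {p p′ q q′} → p ≋ p′ → q ≋ q′ → mul p q ≋ mul p′ q′
  mul-cong {p} {p′} {q} {q′} e f = ≋-trans (mul-congˡ p f)
    (≋-trans (mul-comm p q′) (≋-trans (mul-congˡ q′ e) (mul-comm q′ p′)))

  add-interchange : ∀ p q r s → add (add p q) (add r s) ≋ add (add p r) (add q s)
  add-interchange p q r s = ≋-trans (add-assoc p q (add r s))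
    (≋-trans (add-cong (≋-refl {p}) (add-x∙yz≈y∙xz q r s)) (≋-sym (add-assoc p r (add q s))))

  mul-distribˡ : ∀ p q r → mul p (add q r) ≋ add (mul p q) (mul p r)
  mul-distribˡ []      q r = ≋-refl
  mul-distribˡ (a ∷ p) q r = ≋-trans
    (add-cong (scale-add a q r) (∷-cong (sym (+-identityʳ 0#)) (mul-distribˡ p q r)))
    (add-interchange (scale a q) (scale a r) (0# ∷ mul p q) (0# ∷ mul p r))

  mul-distribʳ : ∀ r p q → mul (add p q) r ≋ add (mul p r) (mul q r)
  mul-distribʳ r p q = ≋-trans (mul-comm (add p q) r)
    (≋-trans (mul-distribˡ r p q) (add-cong (mul-comm r p) (mul-comm r q)))

  mul-scaleˡ : ∀ a p q → mul (scale a p) q ≋ scale a (mul p q)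
  mul-scaleˡ a []      q = ≋-refl
  mul-scaleˡ a (b ∷ p) q = ≋-trans
    (add-cong (scale-scale a b q) (∷-cong (sym (zeroʳ a)) (mul-scaleˡ a p q)))
    (≋-sym (scale-add a (scale b q) (0# ∷ mul p q)))

  mul-shiftˡ : ∀ p q → mul (0# ∷ p) q ≋ 0# ∷ mul p q
  mul-shiftˡ p q = add-cong (scale-0 q) ≋-refl

  mul-assoc : ∀ p q r → mul (mul p q) r ≋ mul p (mul q r)
  mul-assoc []      q r = ≋-refl
  mul-assoc (a ∷ p) q r = ≋-trans (mul-distribʳ r (scale a q) (0# ∷ mul p q))
    (add-cong (mul-scaleˡ a q r)
      (≋-trans (mul-shiftˡ (mul p q) r) (∷-cong refl (mul-assoc p q r))))

  mul-identityˡ : ∀ p → mul (1# ∷ []) p ≋ p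
  mul-identityˡ p = ≋-trans (add-cong (scale-1 p) 0∷[]≋[]) (add-identityʳ p)

  commutativeRing : CommutativeRing c ℓ
  commutativeRing = record
    { Carrier = Poly ; _≈_ = P._≈_ ; _+_ = add ; _*_ = mul ; -_ = map -_
    ; 0# = [] ; 1# = 1# ∷ []
    ; isCommutativeRing = record
      { isRing = record
        { +-isAbelianGroup = record
          { isGroup = record
            { isMonoid = record
              { isSemigroup = record
                { isMagma = record
                  { isEquivalence = record
                    { refl  = λ k → refl
                    ; sym   = λ e k → sym (e k)
                    ; trans = λ e f k → trans (e k) (f k)
                    }
                  ; ∙-cong = λ {p} {p′} {q} {q′} e f → at (add-cong {p} {p′} {q} {q′} (coeffwise e) (coeffwise f))
                  }
                ; assoc = λ p q r → at (add-assoc p q r)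
                }
              ; identity = (λ p k → refl) , λ p → at (add-identityʳ p)
              }
            ; inverse = (λ p → at (≋-trans (add-comm (map -_ p) p) (add-inverseʳ p)))
                      , λ p → at (add-inverseʳ p)
            ; ⁻¹-cong = λ {p} {q} e → at (neg-cong {p} {q} (coeffwise e))
            }
          ; comm = λ p q → at (add-comm p q)
          }
        ; *-cong = λ {p} {p′} {q} {q′} e f → at (mul-cong {p} {p′} {q} {q′} (coeffwise e) (coeffwise f))
        ; *-assoc = λ p q r → at (mul-assoc p q r)
        ; *-identity = (λ p → at (mul-identityˡ p))
                     , λ p → at (≋-trans (mul-comm p (1# ∷ [])) (mul-identityˡ p))
        ; distrib = (λ p q r → at (mul-distribˡ p q r)) , λ r p q → at (mul-distribʳ r p q)
        }
      ; *-comm = λ p q → at (mul-comm p q)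
      }
    }

  module R[X] = CommutativeRing commutativeRing

  -- Evaluation and linear factors

  eval : Poly → Carrier → Carrier
  eval []      x = 0#
  eval (a ∷ p) x = a + x * eval p x

  eval-≋[] : ∀ p x → p ≋ [] → eval p x ≈ 0#
  eval-≋[] []      x e = refl
  eval-≋[] (a ∷ p) x e = begin
    a + x * eval p x  ≈⟨ +-cong (at e zero) (*-congˡ (eval-≋[] p x (coeffwise (λ k → at e (suc k))))) ⟩
    0# + x * 0#       ≈⟨ +-identityˡ _ ⟩
    x * 0#            ≈⟨ zeroʳ x ⟩
    0#                ∎

  eval-cong : ∀ {p q} x → p ≋ q → eval p x ≈ eval q x
  eval-cong {[]}    {q}     x e = sym (eval-≋[] q x (≋-sym e))
  eval-cong {a ∷ p} {[]}    x e = eval-≋[] (a ∷ p) x e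
  eval-cong {a ∷ p} {b ∷ q} x e =
    +-cong (at e zero) (*-congˡ (eval-cong {p} {q} x (coeffwise (λ k → at e (suc k)))))

  eval-add : ∀ p q x → eval (add p q) x ≈ eval p x + eval q x
  eval-add []      q       x = sym (+-identityˡ _)
  eval-add (a ∷ p) []      x = sym (+-identityʳ _)
  eval-add (a ∷ p) (b ∷ q) x = begin
    a + b + x * eval (add p q) x             ≈⟨ +-congˡ (*-congˡ (eval-add p q x)) ⟩
    a + b + x * (eval p x + eval q x)        ≈⟨ +-congˡ (distribˡ x _ _) ⟩
    a + b + (x * eval p x + x * eval q x)    ≈⟨ interchange a b _ _ ⟩
    a + x * eval p x + (b + x * eval q x)    ∎

  eval-scale : ∀ a p x → eval (scale a p) x ≈ a * eval p x
  eval-scale a []      x = sym (zeroʳ a)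
  eval-scale a (b ∷ p) x = begin
    a * b + x * eval (scale a p) x  ≈⟨ +-congˡ (*-congˡ (eval-scale a p x)) ⟩
    a * b + x * (a * eval p x)      ≈⟨ +-congˡ (x*yz≈y*xz x a _) ⟩
    a * b + a * (x * eval p x)      ≈⟨ distribˡ a _ _ ⟨
    a * (b + x * eval p x)          ∎

  eval-mul : ∀ p q x → eval (mul p q) x ≈ eval p x * eval q x
  eval-mul []      q x = sym (zeroˡ _)
  eval-mul (a ∷ p) q x = begin
    eval (add (scale a q) (0# ∷ mul p q)) x             ≈⟨ eval-add (scale a q) _ x ⟩
    eval (scale a q) x + (0# + x * eval (mul p q) x)    ≈⟨ +-cong (eval-scale a q x) (+-identityˡ _) ⟩
    a * eval q x + x * eval (mul p q) x                 ≈⟨ +-congˡ (*-congˡ (eval-mul p q x)) ⟩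
    a * eval q x + x * (eval p x * eval q x)            ≈⟨ +-congˡ (*-assoc x _ _) ⟨
    a * eval q x + x * eval p x * eval q x              ≈⟨ distribʳ _ a _ ⟨
    (a + x * eval p x) * eval q x                       ∎

  eval-X-C : ∀ a x → eval (X P.- C a) x ≈ x + - a
  eval-X-C a x = begin
    0# + - a + x * (1# + x * 0#)  ≈⟨ +-cong (+-identityˡ _) (*-congˡ (trans (+-congˡ (zeroʳ x)) (+-identityʳ 1#))) ⟩
    - a + x * 1#                  ≈⟨ +-congˡ (*-identityʳ x) ⟩
    - a + x                       ≈⟨ +-comm _ _ ⟩
    x + - a                       ∎

  coeff-[X-C]* : ∀ a p k → coeff ((X P.- C a) P.* p) (suc k) ≈ coeff p k + - (a * coeff p (suc k))
  coeff-[X-C]* a p k = begin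
    -- `X - C a` computes to the list `(0# + - a) ∷ 1# ∷ []`, so the product is a scaled copy of `p`
    -- plus a shifted one.
    coeff (add (scale (0# + - a) p) (0# ∷ mul (1# ∷ []) p)) (suc k)
      ≈⟨ coeff-add (scale (0# + - a) p) _ (suc k) ⟩
    coeff (scale (0# + - a) p) (suc k) + coeff (mul (1# ∷ []) p) k
      ≈⟨ +-cong (coeff-scale (0# + - a) p (suc k)) (at (mul-identityˡ p) k) ⟩
    (0# + - a) * coeff p (suc k) + coeff p k
      ≈⟨ +-congʳ (*-congʳ (+-identityˡ _)) ⟩
    - a * coeff p (suc k) + coeff p k
      ≈⟨ +-congʳ (-‿distribˡ-* a _) ⟨
    - (a * coeff p (suc k)) + coeff p k
      ≈⟨ +-comm _ _ ⟩
    coeff p k + - (a * coeff p (suc k))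
      ∎

  -- The coefficients of p vanish one after the other from the top, since
  -- (X − a) p ≈ 0 says that pₖ = a pₖ₊₁.
  [X-C]*≋0⇒≋0 : ∀ a p → (X P.- C a) P.* p ≋ [] → p ≋ []
  [X-C]*≋0⇒≋0 a p e .at k = vanish (length p) k (ℕ.m≤m+n (length p) k)
    where
    vanish : ∀ j k → length p ℕ.≤ j ℕ.+ k → coeff p k ≈ 0#
    vanish zero    k l≤k  = coeff-≥length p k l≤k
    vanish (suc j) k l≤jk = begin
      coeff p k
        ≈⟨ +-identityʳ _ ⟨
      coeff p k + 0#
        ≈⟨ +-congˡ -0#≈0# ⟨
      coeff p k + - 0#
        ≈⟨ +-congˡ (-‿cong (zeroʳ a)) ⟨
      coeff p k + - (a * 0#)
        ≈⟨ +-congˡ (-‿cong (*-congˡ (vanish j (suc k) (ℕ.≤-trans l≤jk (ℕ.≤-reflexive (≡.sym (ℕ.+-suc j k))))))) ⟨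
      coeff p k + - (a * coeff p (suc k))
        ≈⟨ coeff-[X-C]* a p k ⟨
      coeff ((X P.- C a) P.* p) (suc k)
        ≈⟨ at e (suc k) ⟩
      0# ∎

  -- A monic polynomial is not a zero divisor over any commutative ring, so the difference `p - q`
  -- must vanish.
  [X-C]*-cancelˡ : ∀ a p q → (X P.- C a) P.* p P.≈ (X P.- C a) P.* q → p P.≈ q
  [X-C]*-cancelˡ a p q e = x∙y⁻¹≈ε⇒x≈y p q (at ([X-C]*≋0⇒≋0 a (p P.- q) (≋-trans
    {(X P.- C a) P.* (p P.- q)} {(X P.- C a) P.* p P.- (X P.- C a) P.* q}
    (coeffwise (x[y-z]≈xy-xz (X P.- C a) p q))
    (coeffwise (x≈y⇒x∙y⁻¹≈ε {(X P.- C a) P.* p} {(X P.- C a) P.* q} e)))))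
    where
    open import Algebra.Properties.Ring R[X].ring using (x[y-z]≈xy-xz)
    open import Algebra.Properties.Group R[X].+-group using (x≈y⇒x∙y⁻¹≈ε; x∙y⁻¹≈ε⇒x≈y)

  eval-∏[X-C] : ∀ {n} (ρ : Vector Carrier n) x →
    eval (P.product (λ i → X P.- C (ρ i))) x ≈ product (λ i → x + - ρ i)
  eval-∏[X-C] {zero}  ρ x = trans (+-congˡ (zeroʳ x)) (+-identityʳ 1#)
  eval-∏[X-C] {suc n} ρ x = trans
    (eval-mul (X P.- C (ρ zero)) (P.product (λ i → X P.- C (ρ (suc i)))) x)
    (*-cong (eval-X-C (ρ zero) x) (eval-∏[X-C] (λ i → ρ (suc i)) x))

  C-cong : ∀ {a b} → a ≈ b → C a ≋ C b
  C-cong a≈b = ∷-cong a≈b ≋-refl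

  C-* : ∀ a b → C (a * b) ≋ C a P.* C b
  C-* a b = ∷-cong (sym (+-identityʳ _)) ≋-refl

  -C0≋0 : P.- C 0# ≋ []
  -C0≋0 = ≋-trans (C-cong -0#≈0#) 0∷[]≋[]

  X-C0≋X : X P.- C 0# ≋ X
  X-C0≋X = ≋-trans (add-cong (≋-refl {X}) -C0≋0) (add-identityʳ X)

  -- Numbers of the source ring become constant polynomials. With ℚ as source this is the
  -- coefficient morphism of the ring solver, so that identities involving ½ and ¼ are settled by
  -- rational arithmetic.
  C∘ : ∀ {r₁ r₂} {From : RawRing r₁ r₂} {φ : RawRing.Carrier From → Carrier} →
    IsRingHomomorphism From raw φ → From -Raw-AlmostCommutative⟶ fromCommutativeRing commutativeRing
  C∘ {φ = φ} hom = record
    { ⟦_⟧    = λ q → C (φ q)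
    ; +-homo = λ p q → at (C-cong (+-homo p q))
    ; *-homo = λ p q → at (≋-trans (C-cong (*-homo p q)) (C-* (φ p) (φ q)))
    ; -‿homo = λ q → at (C-cong (-‿homo q))
    ; 0-homo = at (≋-trans (C-cong 0#-homo) 0∷[]≋[])
    ; 1-homo = at (C-cong 1#-homo)
    }
    where open IsRingHomomorphism hom

  -- The border entries of λI - A are `- C r`; their sign disappears in the square.
  -C*-C*C≋1 : ∀ {r k} → r * r * k ≈ 1# → (P.- C r) P.* (P.- C r) P.* C k ≋ P.1#
  -C*-C*C≋1 {r} {k} r²k≈1 = ≋-trans
    (mul-cong (≋-sym (C-* (- r) (- r))) (≋-refl {C k}))
    (≋-trans (≋-sym (C-* (- r * - r) k)) (C-cong (trans (*-congʳ -r*-r≈r*r) r²k≈1)))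
    where
    -r*-r≈r*r : - r * - r ≈ r * r
    -r*-r≈r*r = begin
      - r * - r      ≈⟨ -‿distribˡ-* r (- r) ⟨
      - (r * - r)    ≈⟨ -‿cong (-‿distribʳ-* r r) ⟨
      - - (r * r)    ≈⟨ -‿involutive (r * r) ⟩
      r * r          ∎

-- Determinants

module DeterminantProperties {c ℓ} (R : CommutativeRing c ℓ) where
  open CommutativeRing R hiding (zero)
  open Determinant rawRing public
  open import Algebra.Properties.Ring ring using (-‿distribʳ-*; -‿involutive; -1*x≈-x; x[y-z]≈xy-xz; [y-z]x≈yx-zx)
  open import Algebra.Properties.AbelianGroup +-abelianGroup using (⁻¹-∙-comm)
  open import Algebra.Properties.CommutativeSemigroup *-commutativeSemigroup using (x∙yz≈y∙xz; xy∙z≈y∙xz)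
  open import Algebra.Properties.CommutativeMonoid.Sum +-commutativeMonoid using (sum; sum-cong-≋; sum-replicate; sum-replicate-zero)
  open import Algebra.Properties.Semiring.Exp semiring using (_^_)
  open import Algebra.Properties.Monoid.Mult +-monoid using () renaming (_×_ to _·_)
  open import Relation.Binary.Reasoning.Setoid setoid

  sum≈0 : ∀ {n} {f : Fin n → Carrier} → (∀ i → f i ≈ 0#) → sum f ≈ 0#
  sum≈0 {n} f≈0 = trans (sum-cong-≋ f≈0) (sum-replicate-zero n)

  det-cong : ∀ {N} {M M′ : Matrix Carrier N} → (∀ i j → M i j ≈ M′ i j) → det M ≈ det M′
  det-cong {zero}  M≈M′ = refl
  det-cong {suc N} M≈M′ = sum-cong-≋ λ j →
    *-cong (*-congˡ {x = (- 1#) ^ toℕ j} (M≈M′ zero j)) (det-cong λ i k → M≈M′ (suc i) (punchIn j k))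

  cofactorTerm : ∀ {N} → Matrix Carrier (suc N) → Fin (suc N) → Carrier
  cofactorTerm M j = (- 1#) ^ toℕ j * M zero j * det (minor M j)

  cofactorTerm≈0 : ∀ {N} (M : Matrix Carrier (suc N)) j → M zero j ≈ 0# → cofactorTerm M j ≈ 0#
  cofactorTerm≈0 M j M₀ⱼ≈0 = trans (*-congʳ (trans (*-congˡ M₀ⱼ≈0) (zeroʳ _))) (zeroˡ _)

  -- `det` expands along rows, so a column needs an induction: the term at column 0 has a zero
  -- entry, and every other minor again starts with a zero column.
  det-zeroColumn : ∀ {N} (M : Matrix Carrier (suc N)) → (∀ i → M i zero ≈ 0#) → det M ≈ 0#
  det-zeroColumn {N} M M₋₀≈0 = sum≈0 {suc N} {cofactorTerm M} (term N M M₋₀≈0)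
    where
    term : ∀ N (M : Matrix Carrier (suc N)) → (∀ i → M i zero ≈ 0#) → ∀ j → cofactorTerm M j ≈ 0#
    term N       M e zero    = cofactorTerm≈0 M zero (e zero)
    term (suc N) M e (suc j) = trans (*-congˡ (det-zeroColumn (minor M (suc j)) (λ i → e (suc i)))) (zeroʳ _)

  cofactorTerm-0 : ∀ {N} (M : Matrix Carrier (suc N)) →
    cofactorTerm M zero ≈ M zero zero * det (minor M zero)
  cofactorTerm-0 M = *-congʳ (*-identityˡ _)

  cofactorTerm-1 : ∀ {N} (M : Matrix Carrier (suc (suc N))) →
    cofactorTerm M (suc zero) ≈ - (M zero (suc zero) * det (minor M (suc zero)))
  cofactorTerm-1 M = begin
    - 1# * 1# * m * d  ≈⟨ *-congʳ (*-congʳ (*-identityʳ _)) ⟩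
    - 1# * m * d       ≈⟨ *-assoc _ _ _ ⟩
    - 1# * (m * d)     ≈⟨ -1*x≈-x _ ⟩
    - (m * d)          ∎
    where
    m = M zero (suc zero)
    d = det (minor M (suc zero))

  -1*-1*x≈x : ∀ x → - 1# * (- 1# * x) ≈ x
  -1*-1*x≈x x = trans (-1*x≈-x _) (trans (-‿cong (-1*x≈-x x)) (-‿involutive x))

  cofactorTerm-2 : ∀ {N} (M : Matrix Carrier (suc (suc (suc N)))) →
    cofactorTerm M (suc (suc zero)) ≈ M zero (suc (suc zero)) * det (minor M (suc (suc zero)))
  cofactorTerm-2 M = *-congʳ (trans (*-congʳ (-1*-1*x≈x 1#)) (*-identityˡ _))

  laplace₁ : ∀ {N} (M : Matrix Carrier (suc N)) → (∀ j → M zero (suc j) ≈ 0#) →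
    det M ≈ M zero zero * det (minor M zero)
  laplace₁ M e = begin
    cofactorTerm M zero + sum (λ j → cofactorTerm M (suc j))
      ≈⟨ +-cong (cofactorTerm-0 M) (sum≈0 {f = λ j → cofactorTerm M (suc j)} (λ j → cofactorTerm≈0 M (suc j) (e j))) ⟩
    M zero zero * det (minor M zero) + 0#
      ≈⟨ +-identityʳ _ ⟩
    M zero zero * det (minor M zero) ∎

  laplace₂ : ∀ {N} (M : Matrix Carrier (suc (suc N))) → (∀ j → M zero (suc (suc j)) ≈ 0#) →
    det M ≈ M zero zero * det (minor M zero) - M zero (suc zero) * det (minor M (suc zero))
  laplace₂ M e = begin
    t zero + (t (suc zero) + sum (λ j → t (suc (suc j))))
      ≈⟨ +-cong (cofactorTerm-0 M) (+-cong (cofactorTerm-1 M) (sum≈0 {f = λ j → t (suc (suc j))} (λ j → cofactorTerm≈0 M (suc (suc j)) (e j)))) ⟩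
    M zero zero * det (minor M zero) + (- (M zero (suc zero) * det (minor M (suc zero))) + 0#)
      ≈⟨ +-congˡ (+-identityʳ _) ⟩
    M zero zero * det (minor M zero) - M zero (suc zero) * det (minor M (suc zero)) ∎
    where t = cofactorTerm M

  -- Three leading entries occur when the border column is followed by a complete block.
  laplace₃ : ∀ {N} (M : Matrix Carrier (suc (suc (suc N)))) → (∀ j → M zero (suc (suc (suc j))) ≈ 0#) →
    det M ≈ M zero zero * det (minor M zero)
            + (- (M zero (suc zero) * det (minor M (suc zero)))
            + M zero (suc (suc zero)) * det (minor M (suc (suc zero))))
  laplace₃ M e = +-cong (cofactorTerm-0 M) (+-cong (cofactorTerm-1 M) (begin
    t (suc (suc zero)) + sum (λ j → t (suc (suc (suc j))))
      ≈⟨ +-cong (cofactorTerm-2 M) (sum≈0 {f = λ j → t (suc (suc (suc j)))} (λ j → cofactorTerm≈0 M (suc (suc (suc j))) (e j))) ⟩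
    M zero (suc (suc zero)) * det (minor M (suc (suc zero))) + 0#
      ≈⟨ +-identityʳ _ ⟩
    M zero (suc (suc zero)) * det (minor M (suc (suc zero))) ∎))
    where t = cofactorTerm M

  -- After row 0 and either leading column are deleted, row 1 has a single entry left that can be
  -- nonzero. Expanding along it leaves the same lower right block `d` in both terms.
  det-blockTriangular : ∀ {N} (M : Matrix Carrier (suc (suc N))) →
    (∀ j → M zero (suc (suc j)) ≈ 0#) → (∀ j → M (suc zero) (suc (suc j)) ≈ 0#) →
    det M ≈ (M zero zero * M (suc zero) (suc zero) - M zero (suc zero) * M (suc zero) zero)
            * det (λ i j → M (suc (suc i)) (suc (suc j)))
  det-blockTriangular M e₀ e₁ = begin
    det M
      ≈⟨ laplace₂ M e₀ ⟩
    p * det (minor M zero) - q * det (minor M (suc zero))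
      ≈⟨ +-cong (*-congˡ (laplace₁ (minor M zero) e₁)) (-‿cong (*-congˡ (laplace₁ (minor M (suc zero)) e₁))) ⟩
    p * (s * d) - q * (r * d)
      ≈⟨ +-cong (*-assoc _ _ _) (-‿cong (*-assoc _ _ _)) ⟨
    p * s * d - q * r * d
      ≈⟨ [y-z]x≈yx-zx d (p * s) (q * r) ⟨
    (p * s - q * r) * d ∎
    where
    p = M zero zero
    q = M zero (suc zero)
    r = M (suc zero) zero
    s = M (suc zero) (suc zero)
    d = det (λ i j → M (suc (suc i)) (suc (suc j)))

  -- The two-by-two block sits in rows 0, 1 and columns 1, 2; the Laplace terms
  -- that use column 0 in one of these rows leave behind a zero column.
  det-shiftedBlock : ∀ {N} (M : Matrix Carrier (suc (suc (suc N)))) →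
    (∀ j → M zero (suc (suc (suc j))) ≈ 0#) → (∀ j → M (suc zero) (suc (suc (suc j))) ≈ 0#) →
    (∀ i → M (suc (suc i)) (suc zero) ≈ 0#) → (∀ i → M (suc (suc i)) (suc (suc zero)) ≈ 0#) →
    det M ≈ (M zero (suc zero) * M (suc zero) (suc (suc zero)) - M zero (suc (suc zero)) * M (suc zero) (suc zero))
            * det (λ i j → M (suc (suc i)) (punchIn (suc zero) (punchIn (suc zero) j)))
  det-shiftedBlock M e₀ e₁ z₁ z₂ = begin
    det M
      ≈⟨ laplace₃ M e₀ ⟩
    p * det (minor M zero) + (- (q * det (minor M (suc zero))) + r * det (minor M (suc (suc zero))))
      ≈⟨ +-cong (*-congˡ minor₀) (+-cong (-‿cong (*-congˡ minor₁)) (*-congˡ minor₂)) ⟩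
    p * 0# + (- (q * - (u * d)) + r * - (t * d))
      ≈⟨ +-cong (zeroʳ p) (+-cong (trans (-‿cong (sym (-‿distribʳ-* q (u * d)))) (-‿involutive _)) (sym (-‿distribʳ-* r (t * d)))) ⟩
    0# + (q * (u * d) - r * (t * d))
      ≈⟨ +-identityˡ _ ⟩
    q * (u * d) - r * (t * d)
      ≈⟨ +-cong (*-assoc _ _ _) (-‿cong (*-assoc _ _ _)) ⟨
    q * u * d - r * t * d
      ≈⟨ [y-z]x≈yx-zx d (q * u) (r * t) ⟨
    (q * u - r * t) * d ∎
    where
    p = M zero zero
    q = M zero (suc zero)
    r = M zero (suc (suc zero))
    s = M (suc zero) zero
    t = M (suc zero) (suc zero)
    u = M (suc zero) (suc (suc zero))
    d = det (λ i j → M (suc (suc i)) (punchIn (suc zero) (punchIn (suc zero) j)))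
    minor₀ : det (minor M zero) ≈ 0#
    minor₀ = begin
      det (minor M zero)
        ≈⟨ laplace₂ (minor M zero) e₁ ⟩
      t * det (minor (minor M zero) zero) - u * det (minor (minor M zero) (suc zero))
        ≈⟨ +-cong (*-congˡ (det-zeroColumn (minor (minor M zero) zero) z₂)) (-‿cong (*-congˡ (det-zeroColumn (minor (minor M zero) (suc zero)) z₁))) ⟩
      t * 0# - u * 0#
        ≈⟨ +-cong (zeroʳ t) (-‿cong (zeroʳ u)) ⟩
      0# - 0#
        ≈⟨ -‿inverseʳ 0# ⟩
      0# ∎
    skip : ∀ v w {z} → z ≈ 0# → s * z - v * w ≈ - (v * w)
    skip v w z≈0 = trans (+-congʳ (trans (*-congˡ z≈0) (zeroʳ s))) (+-identityˡ _)
    minor₁ : det (minor M (suc zero)) ≈ - (u * d)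
    minor₁ = trans (laplace₂ (minor M (suc zero)) e₁)
      (trans (skip u _ (det-zeroColumn (minor (minor M (suc zero)) zero) z₂))
        (-‿cong (*-congˡ (det-cong {M = minor (minor M (suc zero)) (suc zero)} λ i j → refl))))
    minor₂ : det (minor M (suc (suc zero))) ≈ - (t * d)
    minor₂ = trans (laplace₂ (minor M (suc (suc zero))) e₁)
      (trans (skip t _ (det-zeroColumn (minor (minor M (suc (suc zero))) zero) z₁))
        (-‿cong (*-congˡ (det-cong entries))))
      where
      -- Deleting columns 1 and 2 keeps column 0 in either order of deletion, but the two index maps
      -- agree by computation only once `j` is split.
      entries : ∀ i j → minor (minor M (suc (suc zero))) (suc zero) i j ≈ M (suc (suc i)) (punchIn (suc zero) (punchIn (suc zero) j))
      entries i zero    = refl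
      entries i (suc j) = refl

  -- Determinants of matrices built from two-by-two blocks

  module BorderedBlocks (x c a : Carrier) where

    -- The recursion peels off a whole block, so that rows and minors reduce by computation; the
    -- lemmas on `quotient` below connect it with the triangles of the graph.
    blocks : ∀ n → Matrix Carrier (n ℕ.* 2)
    blocks (suc n) zero          zero          = x
    blocks (suc n) zero          (suc zero)    = c
    blocks (suc n) (suc zero)    zero          = c
    blocks (suc n) (suc zero)    (suc zero)    = x
    blocks (suc n) (suc (suc i)) (suc (suc j)) = blocks n i j
    blocks (suc n) zero          (suc (suc j)) = 0#
    blocks (suc n) (suc zero)    (suc (suc j)) = 0#
    blocks (suc n) (suc (suc i)) zero          = 0#
    blocks (suc n) (suc (suc i)) (suc zero)    = 0#

    bordered : ∀ n → Matrix Carrier (suc (n ℕ.* 2))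
    bordered n zero    zero    = x
    bordered n zero    (suc j) = a
    bordered n (suc i) zero    = a
    bordered n (suc i) (suc j) = blocks n i j

    blocks-diagonal : ∀ n k → blocks n k k ≡ x
    blocks-diagonal (suc n) zero          = ≡.refl
    blocks-diagonal (suc n) (suc zero)    = ≡.refl
    blocks-diagonal (suc n) (suc (suc k)) = blocks-diagonal n k

    blocks-sameBlock : ∀ n k l → k ≢ l → quotient {n} 2 k ≡ quotient {n} 2 l → blocks n k l ≡ c
    blocks-sameBlock (suc n) zero          zero          k≢l _ = contradiction ≡.refl k≢l
    blocks-sameBlock (suc n) zero          (suc zero)    _   _ = ≡.refl
    blocks-sameBlock (suc n) (suc zero)    zero          _   _ = ≡.refl
    blocks-sameBlock (suc n) (suc zero)    (suc zero)    k≢l _ = contradiction ≡.refl k≢l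
    blocks-sameBlock (suc n) (suc (suc k)) (suc (suc l)) k≢l e =
      blocks-sameBlock n k l (λ k≡l → k≢l (≡.cong (λ i → suc (suc i)) k≡l)) (Fin.suc-injective e)

    blocks-otherBlock : ∀ n k l → quotient {n} 2 k ≢ quotient {n} 2 l → blocks n k l ≡ 0#
    blocks-otherBlock (suc n) zero          zero          ≢ = contradiction ≡.refl ≢
    blocks-otherBlock (suc n) zero          (suc zero)    ≢ = contradiction ≡.refl ≢
    blocks-otherBlock (suc n) zero          (suc (suc l)) ≢ = ≡.refl
    blocks-otherBlock (suc n) (suc zero)    zero          ≢ = contradiction ≡.refl ≢
    blocks-otherBlock (suc n) (suc zero)    (suc zero)    ≢ = contradiction ≡.refl ≢
    blocks-otherBlock (suc n) (suc zero)    (suc (suc l)) ≢ = ≡.refl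
    blocks-otherBlock (suc n) (suc (suc k)) zero          ≢ = ≡.refl
    blocks-otherBlock (suc n) (suc (suc k)) (suc zero)    ≢ = ≡.refl
    blocks-otherBlock (suc n) (suc (suc k)) (suc (suc l)) ≢ =
      blocks-otherBlock n k l (λ e → ≢ (≡.cong suc e))

    Δ : Carrier
    Δ = x * x - c * c

    det-blocks : ∀ n → det (blocks n) ≈ Δ ^ n
    det-blocks zero    = refl
    det-blocks (suc n) = trans
      (det-blockTriangular (blocks (suc n)) (λ j → refl) (λ j → refl))
      (*-congˡ (det-blocks n))

    -- Only the block containing the deleted column contributes a
    -- factor other than Δ.
    det-minor-bordered : ∀ n (k : Fin (suc n ℕ.* 2)) →
      (- 1#) ^ toℕ k * det (minor (bordered (suc n)) (suc k)) ≈ a * (x - c) * Δ ^ n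
    det-minor-bordered n zero = begin
      1# * det M                       ≈⟨ *-identityˡ _ ⟩
      -- The rows of the first block now begin with `a`, `c` and `a`, `x`: the border column has
      -- taken the place of the deleted one.
      det M                            ≈⟨ det-blockTriangular M (λ j → refl) (λ j → refl) ⟩
      (a * x - c * a) * det (blocks n) ≈⟨ *-cong (trans (+-congˡ (-‿cong (*-comm c a))) (sym (x[y-z]≈xy-xz a x c))) (det-blocks n) ⟩
      a * (x - c) * Δ ^ n              ∎
      where
      M = minor (bordered (suc n)) (suc zero)
    det-minor-bordered n (suc zero) = begin
      -- Deleting the other column exchanges `x` and `c`, which negates the two-by-two determinant;
      -- the cofactor sign undoes this.
      - 1# * 1# * det M                     ≈⟨ *-cong (*-identityʳ _) (det-blockTriangular M (λ j → refl) (λ j → refl)) ⟩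
      - 1# * ((a * c - x * a) * det (blocks n)) ≈⟨ *-assoc _ _ _ ⟨
      - 1# * (a * c - x * a) * det (blocks n)   ≈⟨ *-cong factor (det-blocks n) ⟩
      a * (x - c) * Δ ^ n                   ∎
      where
      M = minor (bordered (suc n)) (suc (suc zero))
      factor : - 1# * (a * c - x * a) ≈ a * (x - c)
      factor = begin
        - 1# * (a * c - x * a)     ≈⟨ -1*x≈-x _ ⟩
        - (a * c - x * a)          ≈⟨ ⁻¹-∙-comm _ _ ⟨
        - (a * c) - - (x * a)      ≈⟨ +-congˡ (-‿involutive _) ⟩
        - (a * c) + x * a          ≈⟨ +-comm _ _ ⟩
        x * a - a * c              ≈⟨ +-congʳ (*-comm x a) ⟩
        a * x - a * c              ≈⟨ x[y-z]≈xy-xz a x c ⟨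
        a * (x - c)                ∎
    det-minor-bordered (suc n) (suc (suc k)) = begin
      - 1# * (- 1# * (- 1#) ^ toℕ k) * det M
        -- The deleted column lies beyond the first block, which therefore splits off intact as a
        -- factor `Δ`. Blocks have even size, so the sign of the cofactor is that of `k` in the
        -- smaller matrix.
        ≈⟨ *-cong (-1*-1*x≈x _) (det-shiftedBlock M (λ j → refl) (λ j → refl) (λ i → refl) (λ i → refl)) ⟩
      (- 1#) ^ toℕ k * (Δ * det M′)
        ≈⟨ *-congˡ (*-congˡ (det-cong entries)) ⟩
      (- 1#) ^ toℕ k * (Δ * det (minor (bordered (suc n)) (suc k)))
        ≈⟨ x∙yz≈y∙xz _ _ _ ⟩
      Δ * ((- 1#) ^ toℕ k * det (minor (bordered (suc n)) (suc k)))
        ≈⟨ *-congˡ (det-minor-bordered n k) ⟩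
      Δ * (a * (x - c) * Δ ^ n)
        ≈⟨ x∙yz≈y∙xz _ _ _ ⟩
      a * (x - c) * Δ ^ suc n ∎
      where
      M = minor (bordered (suc (suc n))) (suc (suc (suc k)))
      M′ : Matrix Carrier (suc (suc (n ℕ.* 2)))
      M′ i j = M (suc (suc i)) (punchIn (suc zero) (punchIn (suc zero) j))
      entries : ∀ i j → M′ i j ≈ minor (bordered (suc n)) (suc k) i j
      entries i zero    = refl
      entries i (suc j) = refl

    -- In the expansion along the border row, column `suc k` carries one sign more than
    -- `det-minor-bordered` accounts for, hence the minus. The value does not depend on `k`, so the
    -- sum is a multiple of a single term.
    det-bordered : ∀ n → det (bordered (suc n)) ≈
      x * Δ ^ suc n + (suc n ℕ.* 2) · (- (a * a * (x - c) * Δ ^ n))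
    det-bordered n = begin
      1# * x * det (blocks (suc n)) + sum (λ k → cofactorTerm (bordered (suc n)) (suc k))
        ≈⟨ +-cong (*-cong (*-identityˡ x) (det-blocks (suc n))) (sum-cong-≋ term) ⟩
      x * Δ ^ suc n + sum {suc n ℕ.* 2} (λ _ → - (a * a * (x - c) * Δ ^ n))
        ≈⟨ +-congˡ (sum-replicate (suc n ℕ.* 2)) ⟩
      x * Δ ^ suc n + (suc n ℕ.* 2) · (- (a * a * (x - c) * Δ ^ n)) ∎
      where
      term : ∀ k → cofactorTerm (bordered (suc n)) (suc k) ≈ - (a * a * (x - c) * Δ ^ n)
      term k = begin
        - 1# * (- 1#) ^ toℕ k * a * d      ≈⟨ *-congʳ (*-assoc _ _ _) ⟩
        - 1# * ((- 1#) ^ toℕ k * a) * d    ≈⟨ *-assoc _ _ _ ⟩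
        - 1# * ((- 1#) ^ toℕ k * a * d)    ≈⟨ -1*x≈-x _ ⟩
        - ((- 1#) ^ toℕ k * a * d)         ≈⟨ -‿cong (xy∙z≈y∙xz _ a d) ⟩
        - (a * ((- 1#) ^ toℕ k * d))       ≈⟨ -‿cong (*-congˡ (det-minor-bordered n k)) ⟩
        - (a * (a * (x - c) * Δ ^ n))      ≈⟨ -‿cong (*-assoc _ _ _) ⟨
        - (a * (a * (x - c)) * Δ ^ n)      ≈⟨ -‿cong (*-congʳ (*-assoc _ _ _)) ⟨
        - (a * a * (x - c) * Δ ^ n)        ∎
        where d = det (minor (bordered (suc n)) (suc k))

-- Roots

-- The double negations allow for R = ℝ, where equality is not decidable.
record IsStableDomain {c ℓ} (raw : RawRing c ℓ) : Set (c ⊔ ℓ) where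
  open RawRing raw
  field
    isCommutativeRing : IsCommutative raw
    1≉0               : ¬ 1# ≈ 0#
    ≈-stable          : ∀ x y → ¬ ¬ (x ≈ y) → x ≈ y
    noZeroDivisors    : ∀ x y → x * y ≈ 0# → ¬ ¬ (x ≈ 0# ⊎ y ≈ 0#)

module UniqueRoots {c ℓ} (raw : RawRing c ℓ) (isDomain : IsStableDomain raw) where
  open RawRing raw using (Carrier; _≈_; _+_; _*_; -_; 0#; 1#)
  open IsStableDomain isDomain using (isCommutativeRing; 1≉0; ≈-stable; noZeroDivisors)
  open PolynomialProperties raw isCommutativeRing
  open CommutativeRing R hiding (zero; isCommutativeRing; Carrier; _≈_; _+_; _*_; -_; 0#; 1#)
  open import Algebra.Properties.Group +-group using (x∙y⁻¹≈ε⇒x≈y)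
  open import Algebra.Properties.CommutativeMonoid.Sum +-commutativeMonoid using (sum-remove)
  open import Algebra.Properties.CommutativeMonoid.Sum R[X].*-commutativeMonoid using () renaming (sum-remove to product-remove)
  open RawSemiringDefinitions (RawRing.rawSemiring raw) using (product; sum)
  open import Relation.Binary.Reasoning.Setoid setoid
  private module P = Polynomial raw
  open P using (Poly; C; X)

  product≈0⇒factor≈0 : ∀ {n} (v : Vector Carrier n) → product v ≈ 0# → ¬ ¬ (∃[ i ] v i ≈ 0#)
  product≈0⇒factor≈0 {zero}  v 1≈0 _ = 1≉0 1≈0
  product≈0⇒factor≈0 {suc n} v ∏≈0 none =
    noZeroDivisors (v zero) (product (tail v)) ∏≈0 λ where
      (inj₁ v₀≈0) → none (zero , v₀≈0)
      (inj₂ rest) → product≈0⇒factor≈0 (tail v) rest λ (i , vᵢ≈0) → none (suc i , vᵢ≈0)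

  ∏[X-_] : ∀ {n} → Vector Carrier n → Poly
  ∏[X- ρ ] = P.product (λ i → X P.- C (ρ i))

  -- A permutation matching `ρ` with `σ` would be data, and its existence is not a stable statement.
  -- An equation between sums of values of `f` is stable and already suffices for the energy.
  sum-over-roots-unique : (f : Carrier → Carrier) → (∀ x y → x ≈ y → f x ≈ f y) →
    ∀ {n} (ρ σ : Vector Carrier n) → ∏[X- ρ ] P.≈ ∏[X- σ ] →
    sum (λ i → f (ρ i)) ≈ sum (λ i → f (σ i))
  sum-over-roots-unique f f-cong {zero}  ρ σ e = refl
  sum-over-roots-unique f f-cong {suc n} ρ σ e =
    ≈-stable _ _ λ sums≉ →
      product≈0⇒factor≈0 (λ i → ρ zero - σ i) ∏σ≈0 λ (j , r) →
        sums≉ (matched j (x∙y⁻¹≈ε⇒x≈y (ρ zero) (σ j) r))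
    where
    ∏σ≈0 : product (λ i → ρ zero - σ i) ≈ 0#
    ∏σ≈0 = begin
      product (λ i → ρ zero - σ i)  ≈⟨ eval-∏[X-C] σ (ρ zero) ⟨
      eval ∏[X- σ ] (ρ zero)        ≈⟨ eval-cong {∏[X- ρ ]} {∏[X- σ ]} (ρ zero) (coeffwise e) ⟨
      eval ∏[X- ρ ] (ρ zero)        ≈⟨ eval-∏[X-C] ρ (ρ zero) ⟩
      product (λ i → ρ zero - ρ i)  ≈⟨ *-congʳ (-‿inverseʳ (ρ zero)) ⟩
      0# * product (λ i → ρ zero - ρ (suc i)) ≈⟨ zeroˡ _ ⟩
      0#                            ∎
    matched : ∀ j → ρ zero ≈ σ j → sum (λ i → f (ρ i)) ≈ sum (λ i → f (σ i))
    matched j ρ₀≈σⱼ = begin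
      f (ρ zero) + sum (λ i → f (tail ρ i))
        ≈⟨ +-cong (f-cong _ _ ρ₀≈σⱼ) (sum-over-roots-unique f f-cong (tail ρ) (removeAt σ j) rest) ⟩
      f (σ j) + sum (λ i → f (removeAt σ j i))
        ≈⟨ sum-remove {i = j} (λ i → f (σ i)) ⟨
      sum (λ i → f (σ i)) ∎
      where
      factored : ∏[X- ρ ] ≋ (X P.- C (ρ zero)) P.* ∏[X- removeAt σ j ]
      factored = ≋-trans {∏[X- ρ ]} {∏[X- σ ]} (coeffwise e)
        (≋-trans {∏[X- σ ]} {(X P.- C (σ j)) P.* ∏[X- removeAt σ j ]}
          (coeffwise (product-remove {i = j} (λ i → X P.- C (σ i))))
          (mul-cong (add-cong (≋-refl {X}) (neg-cong (C-cong (sym ρ₀≈σⱼ)))) (≋-refl {∏[X- removeAt σ j ]})))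
      rest : ∏[X- tail ρ ] P.≈ ∏[X- removeAt σ j ]
      rest = [X-C]*-cancelˡ (ρ zero) ∏[X- tail ρ ] ∏[X- removeAt σ j ] (at factored)

  roots-determine-sum : (f : Carrier → Carrier) → (∀ x y → x ≈ y → f x ≈ f y) →
    ∀ p {n} (ρ σ : Vector Carrier n) →
    p P.≈ P.product (λ i → X P.- C (ρ i)) → p P.≈ P.product (λ i → X P.- C (σ i)) →
    sum (λ i → f (ρ i)) ≈ sum (λ i → f (σ i))
  roots-determine-sum f f-cong p ρ σ p≈∏ρ p≈∏σ =
    sum-over-roots-unique f f-cong ρ σ λ k → trans (sym (p≈∏ρ k)) (p≈∏σ k)

-- The bordered block matrix over a ring containing ℚ

halves-± : ∀ n → Vector ℚ (n ℕ.* 2)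
halves-± (suc n) zero          = ½
halves-± (suc n) (suc zero)    = -½
halves-± (suc n) (suc (suc i)) = halves-± n i

-- The eigenvalues of the graph with m + 1 triangles.
spectrum : ∀ m → Vector ℚ (suc (suc m ℕ.* 2))
spectrum m zero                = 1ℚ
spectrum m (suc zero)          = -½
spectrum m (suc (suc zero))    = -½
spectrum m (suc (suc (suc i))) = halves-± m i

module ℚ-Algebra {c ℓ} (R : CommutativeRing c ℓ)
  (ι : ℚ.+-*-rawRing -Raw-AlmostCommutative⟶ fromCommutativeRing R) where
  open CommutativeRing R hiding (zero)
  open _-Raw-AlmostCommutative⟶_ ι
  open import Algebra.Properties.Semiring.Exp semiring using (_^_; ^-congˡ)
  open import Algebra.Properties.Semiring.Mult semiring using (×-assoc-*; ×-congʳ) renaming (_×_ to _·_)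
  open import Algebra.Properties.CommutativeMonoid.Sum *-commutativeMonoid using () renaming (sum to product)
  open import Relation.Binary.Reasoning.Setoid setoid
  open DeterminantProperties R

  ι-cong : ∀ {p q} → p ≡.≡ q → ⟦ p ⟧ ≈ ⟦ q ⟧
  ι-cong ≡.refl = refl

  open RingSolver ℚ.+-*-rawRing (fromCommutativeRing R) ι
    (λ p q → Maybe.map ι-cong (dec⇒maybe (p ℚ.≟ q)))
    using (solve; _:=_; _:+_; _:*_; _:-_; :-_; _:^_; con)

  ·≈ι* : ∀ n y → n · y ≈ ⟦ + n / 1 ⟧ * y
  ·≈ι* zero    y = sym (trans (*-congʳ 0-homo) (zeroˡ y))
  ·≈ι* (suc n) y = begin
    y + n · y                      ≈⟨ +-congˡ (·≈ι* n y) ⟩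
    y + ⟦ + n / 1 ⟧ * y            ≈⟨ solve 2 (λ y k → y :+ k :* y := (k :+ con 1ℚ) :* y) refl y ⟦ + n / 1 ⟧ ⟩
    (⟦ + n / 1 ⟧ + ⟦ 1ℚ ⟧) * y     ≈⟨ *-congʳ (+-homo (+ n / 1) 1ℚ) ⟨
    ⟦ + n / 1 ℚ.+ 1ℚ ⟧ * y         ≈⟨ *-congʳ (ι-cong (suc-/ n 0)) ⟨
    ⟦ + suc n / 1 ⟧ * y            ∎

  -- Applied with `n` the number of outer vertices and `y` the square of the border entry: this is
  -- where the number of triangles cancels.
  ·≈½ : ∀ n y → y * ⟦ + (n ℕ.* 2) / 1 ⟧ ≈ 1# → n · y ≈ ⟦ ½ ⟧
  ·≈½ n y y*2n≈1 = begin
    n · y                                         ≈⟨ ·≈ι* n y ⟩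
    ⟦ + n / 1 ⟧ * y                               ≈⟨ solve 2 (λ y k → k :* y := con ½ :* (k :* y :+ k :* y)) refl y ⟦ + n / 1 ⟧ ⟩
    ⟦ ½ ⟧ * (⟦ + n / 1 ⟧ * y + ⟦ + n / 1 ⟧ * y)   ≈⟨ *-congˡ (+-cong (·≈ι* n y) (·≈ι* n y)) ⟨
    ⟦ ½ ⟧ * (n · y + n · y)                       ≈⟨ *-congˡ (×-homo-+ y n n) ⟨
    ⟦ ½ ⟧ * ((n ℕ.+ n) · y)                       ≈⟨ *-congˡ (×-congˡ n+n≡n*2) ⟩
    ⟦ ½ ⟧ * ((n ℕ.* 2) · y)                       ≈⟨ *-congˡ (·≈ι* (n ℕ.* 2) y) ⟩
    ⟦ ½ ⟧ * (⟦ + (n ℕ.* 2) / 1 ⟧ * y)             ≈⟨ *-congˡ (*-comm _ y) ⟩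
    ⟦ ½ ⟧ * (y * ⟦ + (n ℕ.* 2) / 1 ⟧)             ≈⟨ *-congˡ y*2n≈1 ⟩
    ⟦ ½ ⟧ * 1#                                    ≈⟨ *-identityʳ _ ⟩
    ⟦ ½ ⟧                                         ∎
    where
    open import Algebra.Properties.Monoid.Mult +-monoid using (×-homo-+; ×-congˡ)
    n+n≡n*2 : n ℕ.+ n ≡.≡ n ℕ.* 2
    n+n≡n*2 = ≡.trans (≡.cong (n ℕ.+_) (≡.sym (ℕ.+-identityʳ n))) (ℕ.*-comm 2 n)

  module _ (x : Carrier) where

    product-halves-± : ∀ n → product (λ i → x - ⟦ halves-± n i ⟧) ≈ (x ^ 2 - ⟦ + 1 / 4 ⟧) ^ n
    product-halves-± zero    = refl
    product-halves-± (suc n) = begin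
      (x - ⟦ ½ ⟧) * ((x - ⟦ -½ ⟧) * product (λ i → x - ⟦ halves-± n i ⟧))
        ≈⟨ *-congˡ (*-congˡ (product-halves-± n)) ⟩
      (x - ⟦ ½ ⟧) * ((x - ⟦ -½ ⟧) * (x ^ 2 - ⟦ + 1 / 4 ⟧) ^ n)
        ≈⟨ solve 2 (λ x d → (x :- con ½) :* ((x :- con -½) :* d) := (x :^ 2 :- con (+ 1 / 4)) :* d) refl x _ ⟩
      (x ^ 2 - ⟦ + 1 / 4 ⟧) * (x ^ 2 - ⟦ + 1 / 4 ⟧) ^ n ∎

    product-spectrum : ∀ m → product (λ i → x - ⟦ spectrum m i ⟧) ≈
      (x ^ 2 - ⟦ + 1 / 4 ⟧) ^ m * (x - ⟦ 1ℚ ⟧) * (x + ⟦ ½ ⟧) ^ 2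
    product-spectrum m = begin
      (x - ⟦ 1ℚ ⟧) * ((x - ⟦ -½ ⟧) * ((x - ⟦ -½ ⟧) * product (λ i → x - ⟦ halves-± m i ⟧)))
        ≈⟨ *-congˡ (*-congˡ (*-congˡ (product-halves-± m))) ⟩
      (x - ⟦ 1ℚ ⟧) * ((x - ⟦ -½ ⟧) * ((x - ⟦ -½ ⟧) * (x ^ 2 - ⟦ + 1 / 4 ⟧) ^ m))
        ≈⟨ solve 2 (λ x d → (x :- con 1ℚ) :* ((x :- con -½) :* ((x :- con -½) :* d))
                         := d :* (x :- con 1ℚ) :* (x :+ con ½) :^ 2) refl x _ ⟩
      (x ^ 2 - ⟦ + 1 / 4 ⟧) ^ m * (x - ⟦ 1ℚ ⟧) * (x + ⟦ ½ ⟧) ^ 2 ∎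

    -- Two outer vertices of one triangle have degree 2 each, so their Randić entry is ½, negated in
    -- λI - R.
    open BorderedBlocks x ⟦ -½ ⟧

    det-bordered-factored : ∀ a m → a * a * ⟦ + (suc m ℕ.* 2 ℕ.* 2) / 1 ⟧ ≈ 1# →
      det (bordered a (suc m)) ≈ (x ^ 2 - ⟦ + 1 / 4 ⟧) ^ m * (x - ⟦ 1ℚ ⟧) * (x + ⟦ ½ ⟧) ^ 2
    det-bordered-factored a m a²≈ = begin
      det (bordered a (suc m))
        ≈⟨ det-bordered a m ⟩
      x * (Δ a * D) + N · (- (a * a * (x - ⟦ -½ ⟧) * D))
        ≈⟨ +-congˡ (×-congʳ N (solve 4 (λ x y h D → :- (y :* (x :- h) :* D) := y :* (:- ((x :- h) :* D))) refl x (a * a) ⟦ -½ ⟧ D)) ⟩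
      x * (Δ a * D) + N · (a * a * (- ((x - ⟦ -½ ⟧) * D)))
        ≈⟨ +-congˡ (×-assoc-* N _ _) ⟨
      x * (Δ a * D) + (N · (a * a)) * (- ((x - ⟦ -½ ⟧) * D))
        ≈⟨ +-congˡ (*-congʳ (·≈½ N (a * a) a²≈)) ⟩
      x * (Δ a * D) + ⟦ ½ ⟧ * (- ((x - ⟦ -½ ⟧) * D))
        -- Since Δ = (x - ½)(x + ½), the cofactor of `D` is (x + ½)(x² - ½x - ½), and the quadratic
        -- factor is (x - 1)(x + ½).
        ≈⟨ solve 2 (λ x D → x :* ((x :* x :- con -½ :* con -½) :* D) :+ con ½ :* (:- ((x :- con -½) :* D))
                         := D :* (x :- con 1ℚ) :* (x :+ con ½) :^ 2) refl x D ⟩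
      D * (x - ⟦ 1ℚ ⟧) * (x + ⟦ ½ ⟧) ^ 2
        ≈⟨ *-congʳ (*-congʳ (^-congˡ m (solve 1 (λ x → x :* x :- con -½ :* con -½ := x :^ 2 :- con (+ 1 / 4)) refl x))) ⟩
      (x ^ 2 - ⟦ + 1 / 4 ⟧) ^ m * (x - ⟦ 1ℚ ⟧) * (x + ⟦ ½ ⟧) ^ 2 ∎
      where
      N = suc m ℕ.* 2
      D = Δ a ^ m

module BorderedCharPoly {c ℓ} (raw : RawRing c ℓ) (isCR : IsCommutative raw)
  (φ : ℚ → RawRing.Carrier raw) (hom : IsRingHomomorphism ℚ.+-*-rawRing raw φ) where

  open PolynomialProperties raw isCR
  open RawRing raw using (Carrier; _≈_; _*_; 0#; 1#)
  open IsRingHomomorphism hom using (-‿homo)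
  open DeterminantProperties commutativeRing using (det-cong; module BorderedBlocks)
  open ℚ-Algebra commutativeRing (C∘ hom)
  private module P = Polynomial raw
  open P using (Poly; X; C)

  -- `A` stands for the Randić matrix and `M` for λI - A. Both are known only through their entries,
  -- which is all that the determinant depends on.
  module _ (m : ℕ) (r : Carrier) (A : Matrix Carrier (suc (suc m ℕ.* 2)))
    (r²≈ : r * r * φ (+ (suc m ℕ.* 2 ℕ.* 2) / 1) ≈ 1#)
    (A-diagonal : ∀ u → A u u ≈ 0#)
    (A-row₀ : ∀ l → A zero (suc l) ≈ r)
    (A-column₀ : ∀ k → A (suc k) zero ≈ r)
    (A-sameBlock : ∀ {k l} → k ≢ l → quotient {suc m} 2 k ≡ quotient 2 l → A (suc k) (suc l) ≈ φ ½)
    (A-otherBlock : ∀ {k l} → quotient {suc m} 2 k ≢ quotient 2 l → A (suc k) (suc l) ≈ 0#)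
    (M : Matrix Poly (suc (suc m ℕ.* 2)))
    (M-diagonal : ∀ u → M u u ≡ X P.- C (A u u))
    (M-offDiagonal : ∀ {u v} → u ≢ v → M u v ≡ P.- C (A u v))
    where

    private
      n : ℕ
      n = suc m
      a : Poly
      a = P.- C r

    open BorderedBlocks X (C (φ -½)) a

    diagonal : ∀ u → M u u ≋ X
    diagonal u = ≋-trans (≡⇒≋ (M-diagonal u))
      (≋-trans (add-cong (≋-refl {X}) (neg-cong (C-cong (A-diagonal u)))) X-C0≋X)

    offDiagonal : ∀ {u v x} → u ≢ v → A u v ≈ x → M u v ≋ P.- C x
    offDiagonal u≢v e = ≋-trans (≡⇒≋ (M-offDiagonal u≢v)) (neg-cong (C-cong e))

    M≋bordered : ∀ u v → M u v ≋ bordered n u v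
    M≋bordered zero    zero    = diagonal zero
    M≋bordered zero    (suc l) = offDiagonal (λ ()) (A-row₀ l)
    M≋bordered (suc k) zero    = offDiagonal (λ ()) (A-column₀ k)
    M≋bordered (suc k) (suc l) with k Fin.≟ l
    ... | yes ≡.refl = ≋-trans (diagonal (suc k)) (≡⇒≋ (≡.sym (blocks-diagonal n k)))
    ... | no k≢l with quotient {n} 2 k Fin.≟ quotient 2 l
    ...   | yes e = ≋-trans (offDiagonal (λ s → k≢l (Fin.suc-injective s)) (A-sameBlock k≢l e))
                (≋-trans (≋-sym (C-cong (-‿homo ½))) (≡⇒≋ (≡.sym (blocks-sameBlock n k l k≢l e))))
    ...   | no ≢ = ≋-trans (offDiagonal (λ s → k≢l (Fin.suc-injective s)) (A-otherBlock ≢))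
                (≋-trans -C0≋0 (≡⇒≋ (≡.sym (blocks-otherBlock n k l ≢))))

    charPoly-factored : Determinant.det P.rawRing M P.≈
      (X P.^ 2 P.- C (φ (+ 1 / 4))) P.^ m P.* (X P.- C (φ 1ℚ)) P.* (X P.+ C (φ ½)) P.^ 2
    charPoly-factored = R[X].trans
      {Determinant.det P.rawRing M} {Determinant.det P.rawRing (bordered n)}
      {(X P.^ 2 P.- C (φ (+ 1 / 4))) P.^ m P.* (X P.- C (φ 1ℚ)) P.* (X P.+ C (φ ½)) P.^ 2}
      (det-cong {M = M} {bordered n} λ u v → at (M≋bordered u v))
      (det-bordered-factored X a m (at (-C*-C*C≋1 r²≈)))

    charPoly-spectrum : Determinant.det P.rawRing M P.≈ P.product (λ i → X P.- C (φ (spectrum m i)))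
    charPoly-spectrum = R[X].trans
      {Determinant.det P.rawRing M}
      {(X P.^ 2 P.- C (φ (+ 1 / 4))) P.^ m P.* (X P.- C (φ 1ℚ)) P.* (X P.+ C (φ ½)) P.^ 2}
      {P.product (λ i → X P.- C (φ (spectrum m i)))}
      charPoly-factored
      (R[X].sym {P.product (λ i → X P.- C (φ (spectrum m i)))}
        {(X P.^ 2 P.- C (φ (+ 1 / 4))) P.^ m P.* (X P.- C (φ 1ℚ)) P.* (X P.+ C (φ ½)) P.^ 2}
        (product-spectrum X m))

-- Real numbers

open ≡ using (refl; sym; trans; cong; cong₂; subst)
open RationalLemmas

-- `x ≈ℝ y` unfolds to `Null` of the termwise difference, so that congruences and ring laws reduce
-- to closure properties of null sequences.
Null : (ℕ → ℚ) → Set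
Null u = ∀ ε → 0ℚ ℚ.< ε → ∃[ N ] ∀ n → N ℕ.≤ n → ℚ.∣ u n ∣ ℚ.< ε

module _ where
  open import Data.Rational.Base using (_+_; _*_; _-_; -_; ∣_∣)
  open +-*-Solver using (solve; _:=_; _:+_; _:*_; _:-_; :-_)

  null-mono : ∀ {u v} → (∀ n → ∣ u n ∣ ℚ.≤ ∣ v n ∣) → Null v → Null u
  null-mono u≤v null-v ε ε>0 =
    let N , h = null-v ε ε>0 in N , λ n N≤n → ℚ.≤-<-trans (u≤v n) (h n N≤n)

  null-resp : ∀ {u v} → (∀ n → u n ≡ v n) → Null v → Null u
  null-resp u≡v = null-mono (λ n → ℚ.≤-reflexive (cong ∣_∣ (u≡v n)))

  null-0 : Null (λ _ → 0ℚ)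
  null-0 ε ε>0 = 0 , λ _ _ → ε>0

  null-neg : ∀ {u} → Null u → Null (λ n → - u n)
  null-neg = null-mono (λ n → ℚ.≤-reflexive (ℚ.∣-p∣≡∣p∣ _))

  null-+ : ∀ {u v} → Null u → Null v → Null (λ n → u n + v n)
  null-+ {u} {v} null-u null-v ε ε>0 =
    let M , h = null-u (½ * ε) (½* ε>0)
        N , k = null-v (½ * ε) (½* ε>0)
    in M ℕ.⊔ N , λ n M⊔N≤n → begin-strict
      ∣ u n + v n ∣      ≤⟨ ℚ.∣p+q∣≤∣p∣+∣q∣ (u n) (v n) ⟩
      ∣ u n ∣ + ∣ v n ∣  <⟨ ℚ.+-mono-< (h n (ℕ.m⊔n≤o⇒m≤o M N M⊔N≤n)) (k n (ℕ.m⊔n≤o⇒n≤o M N M⊔N≤n)) ⟩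
      ½ * ε + ½ * ε      ≡⟨ halves ε ⟩
      ε                  ∎
    where open ℚ.≤-Reasoning

  -- A Cauchy sequence is eventually bounded by some `B`, so it suffices to bring `u` below ε/B.
  ℝ*null : ∀ x {u} → Null u → Null (λ n → seq x n * u n)
  ℝ*null x {u} null-u ε ε>0 =
    let B , B>0 , M , h = eventuallyBounded (cauchy x)
        N , k = null-u (inv B>0 * ε) (*>0 (inv>0 B>0) ε>0)
    in M ℕ.⊔ N , λ n M⊔N≤n → begin-strict
      ∣ seq x n * u n ∣  ≤⟨ ∣*∣-mono (seq x n) (u n) (h n (ℕ.m⊔n≤o⇒m≤o M N M⊔N≤n)) ℚ.≤-refl ⟩
      B * ∣ u n ∣        <⟨ ℚ.*-monoʳ-<-pos B {{ℚ.positive B>0}} (k n (ℕ.m⊔n≤o⇒n≤o M N M⊔N≤n)) ⟩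
      B * (inv B>0 * ε)  ≡⟨ ℚ.*-assoc B (inv B>0) ε ⟨
      B * inv B>0 * ε    ≡⟨ cong (_* ε) (*-inv B>0) ⟩
      1ℚ * ε             ≡⟨ ℚ.*-identityˡ ε ⟩
      ε                  ∎
    where open ℚ.≤-Reasoning

  pointwise⇒≈ℝ : ∀ {x y} → (∀ n → seq x n ≡ seq y n) → x ≈ℝ y
  pointwise⇒≈ℝ {x} {y} x≡y = null-resp
    (λ n → trans (cong (_- seq y n) (x≡y n)) (ℚ.+-inverseʳ (seq y n))) null-0

  ≈ℝ-refl : ∀ {x} → x ≈ℝ x
  ≈ℝ-refl {x} = pointwise⇒≈ℝ {x} {x} (λ _ → refl)

  ≈ℝ-sym : ∀ {x y} → x ≈ℝ y → y ≈ℝ x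
  ≈ℝ-sym {x} {y} x≈y = null-resp
    (λ n → solve 2 (λ a b → b :- a := :- (a :- b)) refl (seq x n) (seq y n)) (null-neg x≈y)

  ≈ℝ-trans : ∀ {x y z} → x ≈ℝ y → y ≈ℝ z → x ≈ℝ z
  ≈ℝ-trans {x} {y} {z} x≈y y≈z = null-resp
    (λ n → solve 3 (λ a b c → a :- c := (a :- b) :+ (b :- c)) refl (seq x n) (seq y n) (seq z n))
    (null-+ x≈y y≈z)

  +ℝ-cong : ∀ {x y u v} → x ≈ℝ y → u ≈ℝ v → x +ℝ u ≈ℝ y +ℝ v
  +ℝ-cong {x} {y} {u} {v} x≈y u≈v = null-resp
    (λ n → solve 4 (λ a b c d → (a :+ c) :- (b :+ d) := (a :- b) :+ (c :- d)) refl
             (seq x n) (seq y n) (seq u n) (seq v n))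
    (null-+ x≈y u≈v)

  *ℝ-cong : ∀ {x y u v} → x ≈ℝ y → u ≈ℝ v → x *ℝ u ≈ℝ y *ℝ v
  *ℝ-cong {x} {y} {u} {v} x≈y u≈v = null-resp
    (λ n → solve 4 (λ a b c d → a :* c :- b :* d := a :* (c :- d) :+ d :* (a :- b)) refl
             (seq x n) (seq y n) (seq u n) (seq v n))
    (null-+ (ℝ*null x {u−v} u≈v) (ℝ*null v {x−y} x≈y))
    where
    u−v x−y : ℕ → ℚ
    u−v n = seq u n - seq v n
    x−y n = seq x n - seq y n

  -ℝ-cong : ∀ {x y} → x ≈ℝ y → -ℝ x ≈ℝ -ℝ y
  -ℝ-cong {x} {y} x≈y = null-resp
    (λ n → solve 2 (λ a b → (:- a) :- (:- b) := :- (a :- b)) refl (seq x n) (seq y n))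
    (null-neg x≈y)

  ∣∣ℝ-cong : ∀ {x y} → x ≈ℝ y → ∣ x ∣ℝ ≈ℝ ∣ y ∣ℝ
  ∣∣ℝ-cong {x} {y} x≈y ε ε>0 =
    let N , h = x≈y ε ε>0
    in N , λ n N≤n → ∣∣p∣-∣q∣∣≤∣p-q∣ (seq x n) (seq y n) (h n N≤n)

  ≈0⇒null : ∀ {x} → x ≈ℝ fromℚ 0ℚ → Null (seq x)
  ≈0⇒null = null-resp (λ n → sym (ℚ.+-identityʳ _))

  null⇒≈0 : ∀ {x} → Null (seq x) → x ≈ℝ fromℚ 0ℚ
  null⇒≈0 = null-resp (λ n → ℚ.+-identityʳ _)

  -- Take the Cauchy index `N` for δ = ε/4. Comparing the rational ∣x_N∣ with η = ε/2 is decidable.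
  -- If it is not smaller, the tail keeps distance at least δ from 0, which is apartness; hence it
  -- is smaller, and the tail stays below η + δ < ε.
  ¬apart⇒≈0 : ∀ {x} → ¬ ApartFrom0 x → x ≈ℝ fromℚ 0ℚ
  ¬apart⇒≈0 {x} ¬apart = null⇒≈0 {x} null-x
    where
    open ℚ.≤-Reasoning
    null-x : Null (seq x)
    null-x ε ε>0 = N , small
      where
      η = ½ * ε
      η>0 = ½* ε>0
      δ = ½ * η
      δ>0 = ½* η>0
      N = let M , _ = cauchy x δ δ>0 in M
      close : ∀ m n → N ℕ.≤ m → N ℕ.≤ n → ∣ seq x m - seq x n ∣ ℚ.< δ
      close = let _ , h = cauchy x δ δ>0 in h
      below : ∣ seq x N ∣ ℚ.< η
      below with ∣ seq x N ∣ ℚ.<? η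
      ... | yes p = p
      ... | no ¬p = contradiction (δ , δ>0 , N , λ n N≤n → away n N≤n) ¬apart
        where
        away : ∀ n → N ℕ.≤ n → δ ℚ.≤ ∣ seq x n ∣
        away n N≤n = ℚ.≮⇒≥ λ ∣xn∣<δ → ¬p (begin-strict
          ∣ seq x N ∣                            ≤⟨ ∣p∣-∣q∣≤∣p-q∣ (seq x N) (seq x n) ⟩
          ∣ seq x n ∣ + ∣ seq x N - seq x n ∣    <⟨ ℚ.+-mono-< ∣xn∣<δ (close N n ℕ.≤-refl N≤n) ⟩
          δ + δ                                  ≡⟨ halves η ⟩
          η                                      ∎)
      small : ∀ n → N ℕ.≤ n → ∣ seq x n ∣ ℚ.< ε
      small n N≤n = begin-strict
        ∣ seq x n ∣                            ≤⟨ ∣p∣-∣q∣≤∣p-q∣ (seq x n) (seq x N) ⟩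
        ∣ seq x N ∣ + ∣ seq x n - seq x N ∣    <⟨ ℚ.+-mono-< below (close n N N≤n ℕ.≤-refl) ⟩
        η + δ                                  ≡⟨ cong (λ t → η + t) (ℚ.+-identityʳ δ) ⟨
        η + (δ + 0ℚ)                           <⟨ ℚ.+-monoʳ-< η (ℚ.+-monoʳ-< δ δ>0) ⟩
        η + (δ + δ)                            ≡⟨ cong (λ t → η + t) (halves η) ⟩
        η + η                                  ≡⟨ halves ε ⟩
        ε                                      ∎

  ≈0⇒¬apart : ∀ {x} → x ≈ℝ fromℚ 0ℚ → ¬ ApartFrom0 x
  ≈0⇒¬apart {x} x≈0 (c , c>0 , M , h) =
    let N , k = ≈0⇒null {x} x≈0 c c>0
    in ℚ.<-irrefl refl (ℚ.≤-<-trans (h (M ℕ.⊔ N) (ℕ.m≤m⊔n M N)) (k (M ℕ.⊔ N) (ℕ.m≤n⊔m M N)))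

  *-apart : ∀ {x y} → ApartFrom0 x → ApartFrom0 y → ApartFrom0 (x *ℝ y)
  *-apart {x} {y} (c , c>0 , M , h) (d , d>0 , N , k) =
    c * d , *>0 c>0 d>0 , M ℕ.⊔ N , λ n M⊔N≤n → begin
      c * d                  ≤⟨ ℚ.*-monoʳ-≤-nonNeg d {{ℚ.nonNegative (ℚ.<⇒≤ d>0)}} (h n (ℕ.m⊔n≤o⇒m≤o M N M⊔N≤n)) ⟩
      ∣ seq x n ∣ * d        ≤⟨ ℚ.*-monoˡ-≤-nonNeg ∣ seq x n ∣ {{ℚ.∣-∣-nonNeg (seq x n)}} (k n (ℕ.m⊔n≤o⇒n≤o M N M⊔N≤n)) ⟩
      ∣ seq x n ∣ * ∣ seq y n ∣  ≡⟨ ℚ.∣p*q∣≡∣p∣*∣q∣ (seq x n) (seq y n) ⟨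
      ∣ seq x n * seq y n ∣  ∎
    where open ℚ.≤-Reasoning

  fromℚ-apart : ∀ q → q ≢ 0ℚ → ApartFrom0 (fromℚ q)
  fromℚ-apart q q≢0 = ∣ q ∣ , ℚ.positive⁻¹ ∣ q ∣ {{ℚ.nonNeg∧nonZero⇒pos ∣ q ∣ {{ℚ.∣-∣-nonNeg q}} {{ℚ.≢-nonZero (q≢0 ∘ ℚ.∣p∣≡0⇒p≡0 q)}}}} , 0 , λ _ _ → ℚ.≤-refl

  ℝ-isCommutativeRing : IsCommutative ℝ-rawRing
  ℝ-isCommutativeRing = record
    { isRing = record
      { +-isAbelianGroup = record
        { isGroup = record
          { isMonoid = record
            { isSemigroup = record
              { isMagma = record
                { isEquivalence = record
                  { refl = λ {x} → ≈ℝ-refl {x}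
                  ; sym = λ {x} {y} → ≈ℝ-sym {x} {y}
                  ; trans = λ {x} {y} {z} → ≈ℝ-trans {x} {y} {z}
                  }
                ; ∙-cong = λ {x} {y} {u} {v} → +ℝ-cong {x} {y} {u} {v}
                }
              ; assoc = λ x y z → pointwise⇒≈ℝ {x +ℝ y +ℝ z} {x +ℝ (y +ℝ z)} (λ n → ℚ.+-assoc (seq x n) (seq y n) (seq z n))
              }
            ; identity = (λ x → pointwise⇒≈ℝ {fromℚ 0ℚ +ℝ x} {x} (λ n → ℚ.+-identityˡ _))
                       , (λ x → pointwise⇒≈ℝ {x +ℝ fromℚ 0ℚ} {x} (λ n → ℚ.+-identityʳ _))
            }
          ; inverse = (λ x → pointwise⇒≈ℝ { -ℝ x +ℝ x} {fromℚ 0ℚ} (λ n → ℚ.+-inverseˡ (seq x n)))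
                    , (λ x → pointwise⇒≈ℝ {x +ℝ -ℝ x} {fromℚ 0ℚ} (λ n → ℚ.+-inverseʳ (seq x n)))
          ; ⁻¹-cong = λ {x} {y} → -ℝ-cong {x} {y}
          }
        ; comm = λ x y → pointwise⇒≈ℝ {x +ℝ y} {y +ℝ x} (λ n → ℚ.+-comm (seq x n) (seq y n))
        }
      ; *-cong = λ {x} {y} {u} {v} → *ℝ-cong {x} {y} {u} {v}
      ; *-assoc = λ x y z → pointwise⇒≈ℝ {x *ℝ y *ℝ z} {x *ℝ (y *ℝ z)} (λ n → ℚ.*-assoc (seq x n) (seq y n) (seq z n))
      ; *-identity = (λ x → pointwise⇒≈ℝ {fromℚ 1ℚ *ℝ x} {x} (λ n → ℚ.*-identityˡ _))
                   , (λ x → pointwise⇒≈ℝ {x *ℝ fromℚ 1ℚ} {x} (λ n → ℚ.*-identityʳ _))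
      ; distrib = (λ x y z → pointwise⇒≈ℝ {x *ℝ (y +ℝ z)} {x *ℝ y +ℝ x *ℝ z} (λ n → ℚ.*-distribˡ-+ (seq x n) (seq y n) (seq z n)))
                , (λ x y z → pointwise⇒≈ℝ {(y +ℝ z) *ℝ x} {y *ℝ x +ℝ z *ℝ x} (λ n → ℚ.*-distribʳ-+ (seq x n) (seq y n) (seq z n)))
      }
    ; *-comm = λ x y → pointwise⇒≈ℝ {x *ℝ y} {y *ℝ x} (λ n → ℚ.*-comm (seq x n) (seq y n))
    }

  -- Equality amounts to the negation of the difference being apart from 0, and a negation follows
  -- from its own double negation.
  ≈ℝ-stable : ∀ {x y} → ¬ ¬ (x ≈ℝ y) → x ≈ℝ y
  ≈ℝ-stable {x} {y} ¬¬x≈y = null-resp (λ _ → refl)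
    (≈0⇒null {x +ℝ -ℝ y} (¬apart⇒≈0 {x +ℝ -ℝ y} λ apart →
      ¬¬x≈y λ x≈y → ≈0⇒¬apart {x +ℝ -ℝ y} (null⇒≈0 {x +ℝ -ℝ y} x≈y) apart))

  -- Constructively a product of reals can vanish without either factor
  -- being known to vanish, hence the double negation.
  ℝ-noZeroDivisors : ∀ {x y} → x *ℝ y ≈ℝ fromℚ 0ℚ → ¬ ¬ (x ≈ℝ fromℚ 0ℚ ⊎ y ≈ℝ fromℚ 0ℚ)
  ℝ-noZeroDivisors {x} {y} xy≈0 neither =
    neither (inj₁ (¬apart⇒≈0 {x} λ x#0 →
      neither (inj₂ (¬apart⇒≈0 {y} λ y#0 → ≈0⇒¬apart {x *ℝ y} xy≈0 (*-apart {x} {y} x#0 y#0)))))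

-- Square roots and their reciprocals

module _ where
  open import Data.Rational.Base using (_+_; _*_; _-_; -_; ∣_∣)
  open +-*-Solver using (solve; _:=_; _:+_; _:*_; _:-_; :-_)

  square-/ : ∀ a n → (+ a / suc n) * (+ a / suc n) ≡ + (a ℕ.* a) / (suc n ℕ.* suc n)
  square-/ a n = ℚ.toℚᵘ-injective (begin
    toℚᵘ ((+ a / suc n) * (+ a / suc n))          ≈⟨ ℚ.toℚᵘ-homo-* (+ a / suc n) (+ a / suc n) ⟩
    toℚᵘ (+ a / suc n) ℚᵘ.* toℚᵘ (+ a / suc n)    ≈⟨ ℚᵘ.*-cong (ℚ.toℚᵘ-fromℚᵘ (mkℚᵘ (+ a) n)) (ℚ.toℚᵘ-fromℚᵘ (mkℚᵘ (+ a) n)) ⟩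
    mkℚᵘ (+ a) n ℚᵘ.* mkℚᵘ (+ a) n                ≈⟨ *≡* (cong (ℤ._* (+ (suc n ℕ.* suc n))) (sym (ℤ.pos-* a a))) ⟩
    -- `mkℚᵘ` stores the denominator minus one: `n + n * suc n` is the predecessor of
    -- `suc n * suc n`.
    mkℚᵘ (+ (a ℕ.* a)) (n ℕ.+ n ℕ.* suc n)        ≈⟨ ℚ.toℚᵘ-fromℚᵘ (mkℚᵘ (+ (a ℕ.* a)) (n ℕ.+ n ℕ.* suc n)) ⟨
    toℚᵘ (+ (a ℕ.* a) / (suc n ℕ.* suc n))        ∎)
    where open ℚᵘ.≃-Reasoning

  null-1/ : Null (λ n → + 1 / suc n)
  null-1/ ε ε>0 =
    -- `1/-≤` gives only a weak inequality; halving ε makes it strict.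
    let N , h = 1/-≤ (½* ε>0)
    in N , λ n N≤n → begin-strict
      ∣ + 1 / suc n ∣  ≡⟨ ℚ.0≤p⇒∣p∣≡p (/-mono-≤ 0 0 1 n z≤n) ⟩
      + 1 / suc n      ≤⟨ h n N≤n ⟩
      ½ * ε            ≡⟨ ℚ.+-identityʳ _ ⟨
      ½ * ε + 0ℚ       <⟨ ℚ.+-monoʳ-< (½ * ε) (½* ε>0) ⟩
      ½ * ε + ½ * ε    ≡⟨ halves ε ⟩
      ε                ∎
    where open ℚ.≤-Reasoning

  -- The gap is at most (s + e)² - s² = (2s + e)e. Replacing the inner `e` by 1 turns the bound, for
  -- s the approximations of a root and e = 1/(n+1), into a Cauchy sequence times a null sequence,
  -- as `ℝ*null` requires.
  square-gap : ∀ {s e q} → 0ℚ ℚ.≤ e → e ℚ.≤ 1ℚ → s * s ℚ.≤ q → q ℚ.≤ (s + e) * (s + e) →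
    ∣ s * s - q ∣ ℚ.≤ ∣ (s + s + 1ℚ) * e ∣
  square-gap {s} {e} {q} e≥0 e≤1 lower upper = begin
    ∣ s * s - q ∣              ≡⟨ ∣p-q∣≡∣q-p∣ (s * s) q ⟩
    ∣ q - s * s ∣              ≡⟨ ℚ.0≤p⇒∣p∣≡p (subst (ℚ._≤ q - s * s) (ℚ.+-inverseʳ (s * s)) (ℚ.+-monoˡ-≤ (- (s * s)) lower)) ⟩
    q - s * s                  ≤⟨ ℚ.+-monoˡ-≤ (- (s * s)) upper ⟩
    (s + e) * (s + e) - s * s  ≡⟨ solve 2 (λ s e → (s :+ e) :* (s :+ e) :- s :* s := (s :+ s :+ e) :* e) refl s e ⟩
    (s + s + e) * e            ≤⟨ ℚ.*-monoʳ-≤-nonNeg e {{ℚ.nonNegative e≥0}} (ℚ.+-monoʳ-≤ (s + s) e≤1) ⟩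
    (s + s + 1ℚ) * e           ≤⟨ p≤∣p∣ _ ⟩
    ∣ (s + s + 1ℚ) * e ∣       ∎
    where open ℚ.≤-Reasoning

  √*√≈ : ∀ d → √ d *ℝ √ d ≈ℝ fromℕ d
  √*√≈ d = null-mono bound (ℝ*null (√ d +ℝ √ d +ℝ fromℚ 1ℚ) null-1/)
    where
    bound : ∀ n → ∣ √-approx d n * √-approx d n - + d / 1 ∣ ℚ.≤ ∣ (√-approx d n + √-approx d n + 1ℚ) * (+ 1 / suc n) ∣
    bound n = square-gap {√-approx d n} {+ 1 / suc n} {+ d / 1}
      (/-mono-≤ 0 0 1 n z≤n)
      (/-mono-≤ 1 n 1 0 (s≤s z≤n))
      (subst (ℚ._≤ + d / 1) (sym (square-/ a n))
        (/-mono-≤ (a ℕ.* a) n² d 0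
          (subst (ℕ._≤ d ℕ.* suc n²) (sym (ℕ.*-identityʳ (a ℕ.* a))) (⌊√⌋-lower (d ℕ.* suc n²)))))
      (subst (λ t → + d / 1 ℚ.≤ t * t) (suc-/ a n)
        (subst (+ d / 1 ℚ.≤_) (sym (square-/ (suc a) n))
          (/-mono-≤ d 0 (suc a ℕ.* suc a) n²
            (subst (d ℕ.* suc n² ℕ.≤_) (sym (ℕ.*-identityʳ (suc a ℕ.* suc a))) (ℕ.<⇒≤ (⌊√⌋-upper (d ℕ.* suc n²)))))))
      where
      a = sqrtNum d n
      -- One less than the square of `suc n`, so `suc n²` is that square.
      n² = n ℕ.+ n ℕ.* suc n

-- The lower bound 1 in `√-apart` holds from index 0 on, so the junk value of `1/₀_` never occurs
-- and the product is 1 in every term.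
√*1/√≈1 : ∀ d .{{_ : ℕ.NonZero d}} → √ d *ℝ 1/√ d ≈ℝ fromℚ 1ℚ
√*1/√≈1 d = pointwise⇒≈ℝ {√ d *ℝ 1/√ d} {fromℚ 1ℚ} λ n → *-1/₀ (√-approx≢0 d n)
  where
  √-approx≢0 : ∀ d .{{_ : ℕ.NonZero d}} n → √-approx d n ≢ 0ℚ
  √-approx≢0 (suc d) n = let _ , _ , _ , 1≤ = √-apart (suc d) in apart⇒≢0 (ℚ.positive⁻¹ 1ℚ) (1≤ n z≤n)

1/√-square : ∀ d .{{_ : ℕ.NonZero d}} → 1/√ d *ℝ 1/√ d *ℝ fromℕ d ≈ℝ fromℚ 1ℚ
1/√-square d = reciprocal-square ℝ-rawRing ℝ-isCommutativeRing (√ d) (1/√ d) (fromℕ d) (√*√≈ d) (√*1/√≈1 d)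

⌊√[k*k]⌋≡k : ∀ k → ⌊√ k ℕ.* k ⌋ ≡ k
⌊√[k*k]⌋≡k k = ℕ.≤-antisym
  (ℕ.≤-pred (square-cancel-< {⌊√ k ℕ.* k ⌋} {suc k}
    (ℕ.≤-<-trans (⌊√⌋-lower (k ℕ.* k)) (ℕ.*-mono-< (ℕ.n<1+n k) (ℕ.n<1+n k)))))
  (ℕ.≤-pred (square-cancel-< {k} {suc ⌊√ k ℕ.* k ⌋} (⌊√⌋-upper (k ℕ.* k))))

multiple-/ : ∀ a b n → a ≡ b ℕ.* suc n → + a / suc n ≡ + b / 1
multiple-/ a b n e = ℚ.≤-antisym
  (/-mono-≤ a n b 0 (ℕ.≤-reflexive a*1≡b*n))
  (/-mono-≤ b 0 a n (ℕ.≤-reflexive (sym a*1≡b*n)))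
  where
  a*1≡b*n : a ℕ.* 1 ≡ b ℕ.* suc n
  a*1≡b*n = trans (ℕ.*-identityʳ a) e

-- The root is an integer and hence a multiple of 1/(n+1) for every `n`, so rounding down loses
-- nothing.
√-perfectSquare : ∀ k n → √-approx (k ℕ.* k) n ≡ + k / 1
√-perfectSquare k n = multiple-/ (sqrtNum (k ℕ.* k) n) k n
  (trans (cong ⌊√_⌋ (square-* k (suc n))) (⌊√[k*k]⌋≡k (k ℕ.* suc n)))
  where
  square-* : ∀ k s → k ℕ.* k ℕ.* (s ℕ.* s) ≡ (k ℕ.* s) ℕ.* (k ℕ.* s)
  square-* = solve-∀

1/√4≈½ : 1/√ 4 ≈ℝ fromℚ ½
1/√4≈½ = pointwise⇒≈ℝ {1/√ 4} {fromℚ ½} λ n → cong 1/₀_ (√-perfectSquare 2 n)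

-- Degrees in the friendship graph

length-filter-cong : ∀ {a b p q} {A : Set a} {B : Set b} {P : Pred A p} {Q : Pred B q}
  (P? : Decidable P) (Q? : Decidable Q) {n} (f : Fin n → A) (g : Fin n → B) →
  (∀ i → P (f i) → Q (g i)) → (∀ i → Q (g i) → P (f i)) →
  length (filter P? (tabulate f)) ≡ length (filter Q? (tabulate g))
length-filter-cong P? Q? {zero}  f g to from = refl
length-filter-cong P? Q? {suc n} f g to from with P? (f zero) | Q? (g zero)
... | yes _  | yes _  = cong suc (length-filter-cong P? Q? (f ∘ suc) (g ∘ suc) (to ∘ suc) (from ∘ suc))
... | no _   | no _   = length-filter-cong P? Q? (f ∘ suc) (g ∘ suc) (to ∘ suc) (from ∘ suc)
... | yes p  | no ¬q  = contradiction (to zero p) ¬q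
... | no ¬p  | yes q  = contradiction (from zero q) ¬p

module _ (n : ℕ) where
  open Friendship n using (triangle)

  Partner : Fin (n ℕ.* 2) → Pred (Fin (n ℕ.* 2)) _
  Partner k l = k ≢ l × triangle k ≡ triangle l

  partner? : ∀ k → Decidable (Partner k)
  partner? k l = ¬? (k Fin.≟ l) ×-dec (triangle k Fin.≟ triangle l)

-- The two vertices of the first triangle are each other's partners, and every later vertex has a
-- triangle index that is a successor. For later `k` the first triangle is filtered out by
-- computation, and what remains is the graph with one triangle fewer.
uniquePartner : ∀ n k → length (filter (partner? n k) (allFin (n ℕ.* 2))) ≡ 1
uniquePartner (suc n) zero = cong (suc ∘ length) (filter-none (partner? (suc n) zero) {xs = tabulate {n = n ℕ.* 2} (λ l → suc (suc l))} (tabulate⁺ λ { l (_ , ()) }))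
uniquePartner (suc n) (suc zero) = cong (suc ∘ length) (filter-none (partner? (suc n) (suc zero)) {xs = tabulate {n = n ℕ.* 2} (λ l → suc (suc l))} (tabulate⁺ λ { l (_ , ()) }))
uniquePartner (suc n) (suc (suc k)) = trans
  (length-filter-cong (partner? (suc n) (suc (suc k))) (partner? n k) (λ l → suc (suc l)) (λ l → l)
    (λ l (k≢l , e) → (λ k≡l → k≢l (cong (λ i → suc (suc i)) k≡l)) , Fin.suc-injective e)
    (λ l (k≢l , e) → (λ k≡l → k≢l (Fin.suc-injective (Fin.suc-injective k≡l))) , cong suc e))
  (uniquePartner n k)

module _ (n : ℕ) where
  open Graph (friendship n)

  degree-centre : degree zero ≡ n ℕ.* 2
  degree-centre = trans
    (cong length (filter-all (Friendship.adj? n zero) {xs = tabulate suc} (tabulate⁺ λ l → _)))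
    (length-tabulate suc)

  degree-outer : ∀ k → degree (suc k) ≡ 2
  -- The `suc` counts the centre, which heads the list of neighbours.
  degree-outer k = cong suc (trans
    (length-filter-cong (Friendship.adj? n (suc k)) (partner? n k) suc (λ l → l) (λ l p → p) (λ l p → p))
    (uniquePartner n k))

seq-1/√ : ∀ d .{{_ : ℕ.NonZero d}} n → seq (1/√ d) n ≡ 1/₀ (√-approx d n)
seq-1/√ d n = refl

-- Entries of the Randić matrix and of the characteristic matrix

module RandićEntries (G : Graph) where
  open Graph G

  -- The record keeps the abstraction over u ~? v in adjacentEntry from
  -- normalising the approximations of the square root.
  record AdjacentEntry (u v : Fin order) (x : ℝ) : Set where
    constructor mkEntry
    field seq≡ : ∀ n → seq x n ≡ 1/₀ (√-approx (degree u ℕ.* degree v) n)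

  adjacentEntry : ∀ {u v} → u ~ v → AdjacentEntry u v (randićMatrix u v)
  adjacentEntry {u} {v} u~v with u ~? v
  ... | yes u~v′ = mkEntry (seq-1/√ (degree u ℕ.* degree v)
                     {{ℕ.m*n≢0 _ _ {{degree-nonZero u~v′}} {{degree-nonZero (sym-~ u~v′)}}}})
  ... | no ¬u~v  = contradiction u~v ¬u~v

  -- The terms of `1/√ d` depend only on the number `d`, not on the proof that it is nonzero, so the
  -- product of degrees can be replaced term by term.
  randić-adjacent : ∀ {u v} → u ~ v → ∀ {d} .{{_ : ℕ.NonZero d}} → degree u ℕ.* degree v ≡ d →
    randićMatrix u v ≈ℝ 1/√ d
  randić-adjacent {u} {v} u~v {d} e = pointwise⇒≈ℝ {randićMatrix u v} {1/√ d} λ n →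
    trans (AdjacentEntry.seq≡ (adjacentEntry u~v) n) (cong (λ d → 1/₀ (√-approx d n)) e)

  randić-nonadjacent : ∀ {u v} → ¬ (u ~ v) → randićMatrix u v ≡ fromℚ 0ℚ
  randić-nonadjacent {u} {v} ¬u~v with u ~? v
  ... | yes u~v = contradiction u~v ¬u~v
  ... | no _    = refl

module CharMatrixEntries {N} (M : Matrix ℝ N) where
  open ℝ[X] using (Poly; X; C; _-_; -_)

  -- Abstract because the with-abstractions below normalise their goals,
  -- which for the Cauchy proofs inside X - C x does not finish in practice.
  abstract
    X-C : ℝ → Poly
    X-C x = X - C x

    X-C≡ : ∀ x → X-C x ≡ X - C x
    X-C≡ x = refl

    -C : ℝ → Poly
    -C x = - C x

    -C≡ : ∀ x → -C x ≡ - C x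
    -C≡ x = refl

  diagonal : ∀ i → charMatrix M i i ≡ X-C (M i i)
  diagonal i with i Fin.≟ i
  ... | yes _  = sym (X-C≡ (M i i))
  ... | no i≢i = contradiction refl i≢i

  offDiagonal : ∀ {i j} → i ≢ j → charMatrix M i j ≡ -C (M i j)
  offDiagonal {i} {j} i≢j with i Fin.≟ j
  ... | yes i≡j = contradiction i≡j i≢j
  ... | no _    = sym (-C≡ (M i j))

  charMatrix-diagonal : ∀ i → charMatrix M i i ≡ X - C (M i i)
  charMatrix-diagonal i = trans (diagonal i) (X-C≡ (M i i))

  charMatrix-offDiagonal : ∀ {i j} → i ≢ j → charMatrix M i j ≡ - C (M i j)
  charMatrix-offDiagonal {i} {j} i≢j = trans (offDiagonal i≢j) (-C≡ (M i j))

-- The friendship graph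

fromℚ-homomorphism : IsRingHomomorphism ℚ.+-*-rawRing ℝ-rawRing fromℚ
fromℚ-homomorphism = record
  { isSemiringHomomorphism = record
    { isNearSemiringHomomorphism = record
      { +-isMonoidHomomorphism = record
        { isMagmaHomomorphism = record
          { isRelHomomorphism = record { cong = λ { {p} refl → ≈ℝ-refl {fromℚ p} } }
          ; homo = λ p q → pointwise⇒≈ℝ {fromℚ (p ℚ.+ q)} {fromℚ p +ℝ fromℚ q} λ _ → refl
          }
        ; ε-homo = ≈ℝ-refl {fromℚ 0ℚ}
        }
      ; *-homo = λ p q → pointwise⇒≈ℝ {fromℚ (p ℚ.* q)} {fromℚ p *ℝ fromℚ q} λ _ → refl
      }
    ; 1#-homo = ≈ℝ-refl {fromℚ 1ℚ}
    }
  ; -‿homo = λ q → pointwise⇒≈ℝ {fromℚ (ℚ.- q)} { -ℝ fromℚ q} λ _ → refl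
  }

ℝ-isStableDomain : IsStableDomain ℝ-rawRing
ℝ-isStableDomain = record
  { isCommutativeRing = ℝ-isCommutativeRing
  ; 1≉0               = λ 1≈0 → ≈0⇒¬apart {fromℚ 1ℚ} 1≈0 (fromℚ-apart 1ℚ λ ())
  ; ≈-stable          = λ x y → ≈ℝ-stable {x} {y}
  ; noZeroDivisors    = λ x y → ℝ-noZeroDivisors {x} {y}
  }

open RawSemiringDefinitions (RawRing.rawSemiring ℝ-rawRing) using (sum)

module ℝ-CharPoly = BorderedCharPoly ℝ-rawRing ℝ-isCommutativeRing fromℚ fromℚ-homomorphism
module ℝ-UniqueRoots = UniqueRoots ℝ-rawRing ℝ-isStableDomain

≡⇒≈ℝ : ∀ {x y} → x ≡ y → x ≈ℝ y
≡⇒≈ℝ {x} refl = ≈ℝ-refl {x}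

-- Stated for a variable matrix A, which the type checker cannot unfold.
module _ (m : ℕ) (A : Matrix ℝ (suc (suc m ℕ.* 2)))
  (A-diagonal : ∀ u → A u u ≈ℝ fromℚ 0ℚ)
  (A-row₀ : ∀ l → A zero (suc l) ≈ℝ 1/√ (suc m ℕ.* 2 ℕ.* 2))
  (A-column₀ : ∀ k → A (suc k) zero ≈ℝ 1/√ (suc m ℕ.* 2 ℕ.* 2))
  (A-sameBlock : ∀ {k l} → k ≢ l → quotient {suc m} 2 k ≡ quotient 2 l → A (suc k) (suc l) ≈ℝ fromℚ ½)
  (A-otherBlock : ∀ {k l} → quotient {suc m} 2 k ≢ quotient 2 l → A (suc k) (suc l) ≈ℝ fromℚ 0ℚ)
  where
  open ℝ[X]
  open CharMatrixEntries A

  private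
    d : ℕ
    d = suc m ℕ.* 2 ℕ.* 2

  bordered-charPoly : charPoly A ≈ (X ^ 2 - C (fromℚ (+ 1 / 4))) ^ m * (X - C (fromℚ 1ℚ)) * (X + C (fromℚ ½)) ^ 2
  bordered-charPoly = ℝ-CharPoly.charPoly-factored m (1/√ d) A (1/√-square d) A-diagonal A-row₀ A-column₀
    (λ {k} {l} → A-sameBlock {k} {l}) (λ {k} {l} → A-otherBlock {k} {l})
    (charMatrix A) charMatrix-diagonal charMatrix-offDiagonal

  bordered-spectrum : IsSpectrum A (λ i → fromℚ (spectrum m i))
  bordered-spectrum = ℝ-CharPoly.charPoly-spectrum m (1/√ d) A (1/√-square d) A-diagonal A-row₀ A-column₀
    (λ {k} {l} → A-sameBlock {k} {l}) (λ {k} {l} → A-otherBlock {k} {l})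
    (charMatrix A) charMatrix-diagonal charMatrix-offDiagonal

-- The energy

spectra-sameEnergy : ∀ {N} (A : Matrix ℝ N) ρ σ → IsSpectrum A ρ → IsSpectrum A σ →
  sum (λ i → ∣ ρ i ∣ℝ) ≈ℝ sum (λ i → ∣ σ i ∣ℝ)
spectra-sameEnergy A = ℝ-UniqueRoots.roots-determine-sum ∣_∣ℝ (λ x y → ∣∣ℝ-cong {x} {y}) (charPoly A)

module _ where
  open import Algebra.Properties.Monoid.Sum ℚ.+-0-monoid using () renaming (sum to ℚ-sum; sum-cong-≗ to ℚ-sum-cong)
  open ≡.≡-Reasoning

  seq-sum : ∀ {n} (v : Vector ℝ n) k → seq (sum v) k ≡ ℚ-sum (λ i → seq (v i) k)
  seq-sum {zero}  v k = refl
  seq-sum {suc n} v k = cong (seq (v zero) k ℚ.+_) (seq-sum (λ i → v (suc i)) k)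

  ℚ-sum-suc : ∀ {n} (v : Vector ℚ (suc n)) → ℚ-sum v ≡ v zero ℚ.+ ℚ-sum (λ i → v (suc i))
  ℚ-sum-suc v = refl

  sum-halves : ∀ n → ℚ-sum {n ℕ.* 2} (λ _ → ½) ≡ + n / 1
  sum-halves zero    = refl
  sum-halves (suc n) = begin
    ℚ-sum {suc n ℕ.* 2} (λ _ → ½)              ≡⟨ ℚ-sum-suc {suc (n ℕ.* 2)} (λ _ → ½) ⟩
    ½ ℚ.+ ℚ-sum {suc (n ℕ.* 2)} (λ _ → ½)      ≡⟨ cong (½ ℚ.+_) (ℚ-sum-suc {n ℕ.* 2} (λ _ → ½)) ⟩
    ½ ℚ.+ (½ ℚ.+ ℚ-sum {n ℕ.* 2} (λ _ → ½))    ≡⟨ cong (λ q → ½ ℚ.+ (½ ℚ.+ q)) (sum-halves n) ⟩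
    ½ ℚ.+ (½ ℚ.+ + n / 1)                      ≡⟨ ℚ.+-assoc ½ ½ (+ n / 1) ⟨
    1ℚ ℚ.+ + n / 1                             ≡⟨ ℚ.+-comm 1ℚ (+ n / 1) ⟩
    + n / 1 ℚ.+ 1ℚ                             ≡⟨ suc-/ n 0 ⟨
    + suc n / 1                                ∎

  ∣halves-±∣ : ∀ n i → ℚ.∣ halves-± n i ∣ ≡ ½
  ∣halves-±∣ (suc n) zero          = refl
  ∣halves-±∣ (suc n) (suc zero)    = refl
  ∣halves-±∣ (suc n) (suc (suc i)) = ∣halves-±∣ n i

  ∣spectrum-suc∣ : ∀ m i → ℚ.∣ spectrum m (suc i) ∣ ≡ ½
  ∣spectrum-suc∣ m zero          = refl
  ∣spectrum-suc∣ m (suc zero)    = refl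
  ∣spectrum-suc∣ m (suc (suc i)) = ∣halves-±∣ m i

  -- Beside the eigenvalue 1 there are 2(m + 1) eigenvalues of absolute value ½, one for each outer
  -- vertex in number, contributing m + 1 in total.
  sum-∣spectrum∣ : ∀ m → sum (λ i → ∣ fromℚ (spectrum m i) ∣ℝ) ≈ℝ fromℕ (suc m ℕ.+ 1)
  sum-∣spectrum∣ m = pointwise⇒≈ℝ {sum (λ i → ∣ fromℚ (spectrum m i) ∣ℝ)} {fromℕ (suc m ℕ.+ 1)} λ k → begin
    seq (sum (λ i → ∣ fromℚ (spectrum m i) ∣ℝ)) k  ≡⟨ seq-sum (λ i → ∣ fromℚ (spectrum m i) ∣ℝ) k ⟩
    ℚ-sum (λ i → ℚ.∣ spectrum m i ∣)               ≡⟨ ℚ-sum-suc (λ i → ℚ.∣ spectrum m i ∣) ⟩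
    1ℚ ℚ.+ ℚ-sum (λ i → ℚ.∣ spectrum m (suc i) ∣)  ≡⟨ cong (1ℚ ℚ.+_) (ℚ-sum-cong (∣spectrum-suc∣ m)) ⟩
    1ℚ ℚ.+ ℚ-sum {suc m ℕ.* 2} (λ _ → ½)           ≡⟨ cong (1ℚ ℚ.+_) (sum-halves (suc m)) ⟩
    1ℚ ℚ.+ + suc m / 1                             ≡⟨ ℚ.+-comm 1ℚ (+ suc m / 1) ⟩
    + suc m / 1 ℚ.+ 1ℚ                             ≡⟨ suc-/ (suc m) 0 ⟨
    + suc (suc m) / 1                              ≡⟨ cong (λ j → + j / 1) (ℕ.+-comm 1 (suc m)) ⟩
    + (suc m ℕ.+ 1) / 1                            ∎

-- The Randić matrix of the friendship graph

module _ (m : ℕ) where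
  private
    n : ℕ
    n = suc m
    G : Graph
    G = friendship n

  open Graph G
  open RandićEntries G
  open Friendship n using (triangle)
  open ℝ[X] using (X; C; _-_; _+_; _*_; _^_)

  randić-loop : ∀ u → randićMatrix u u ≈ℝ fromℚ 0ℚ
  randić-loop u = ≡⇒≈ℝ (randić-nonadjacent {u} {u} (irrefl refl))

  randić-row₀ : ∀ l → randićMatrix zero (suc l) ≈ℝ 1/√ (n ℕ.* 2 ℕ.* 2)
  randić-row₀ l = randić-adjacent {zero} {suc l} _ (cong₂ ℕ._*_ (degree-centre n) (degree-outer n l))

  randić-column₀ : ∀ k → randićMatrix (suc k) zero ≈ℝ 1/√ (n ℕ.* 2 ℕ.* 2)
  randić-column₀ k = randić-adjacent {suc k} {zero} _
    (trans (cong₂ ℕ._*_ (degree-outer n k) (degree-centre n)) (ℕ.*-comm 2 (n ℕ.* 2)))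

  randić-sameTriangle : ∀ {k l} → k ≢ l → triangle k ≡ triangle l → randićMatrix (suc k) (suc l) ≈ℝ fromℚ ½
  randić-sameTriangle {k} {l} k≢l e = ≈ℝ-trans {randićMatrix (suc k) (suc l)} {1/√ 4} {fromℚ ½}
    (randić-adjacent {suc k} {suc l} (k≢l , e) (cong₂ ℕ._*_ (degree-outer n k) (degree-outer n l)))
    1/√4≈½

  randić-otherTriangle : ∀ {k l} → triangle k ≢ triangle l → randićMatrix (suc k) (suc l) ≈ℝ fromℚ 0ℚ
  randić-otherTriangle {k} {l} ≢ = ≡⇒≈ℝ (randić-nonadjacent {suc k} {suc l} λ (_ , e) → ≢ e)

  RP-friendship : RP G ℝ[X].≈ (X ^ 2 - C (fromℚ (+ 1 / 4))) ^ m * (X - C (fromℚ 1ℚ)) * (X + C (fromℚ ½)) ^ 2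
  RP-friendship = bordered-charPoly m (Graph.randićMatrix (friendship (suc m)))
    randić-loop randić-row₀ randić-column₀
    (λ {k} {l} → randić-sameTriangle {k} {l}) (λ {k} {l} → randić-otherTriangle {k} {l})

  friendship-spectrum : IsSpectrum (Graph.randićMatrix (friendship (suc m))) (λ i → fromℚ (spectrum m i))
  friendship-spectrum = bordered-spectrum m (Graph.randićMatrix (friendship (suc m)))
    randić-loop randić-row₀ randić-column₀
    (λ {k} {l} → randić-sameTriangle {k} {l}) (λ {k} {l} → randić-otherTriangle {k} {l})

  RE-friendship : HasRE (friendship (suc m)) (fromℕ (suc m ℕ.+ 1))
  RE-friendship = ((λ i → fromℚ (spectrum m i)) , friendship-spectrum) , λ ρ ρ-spectrum →
    ≈ℝ-trans {sum (λ i → ∣ ρ i ∣ℝ)} {sum (λ i → ∣ fromℚ (spectrum m i) ∣ℝ)} {fromℕ (suc m ℕ.+ 1)}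
      (spectra-sameEnergy (Graph.randićMatrix (friendship (suc m))) ρ (λ i → fromℚ (spectrum m i)) ρ-spectrum friendship-spectrum)
      (sum-∣spectrum∣ m)

theorem6 : (n : ℕ) → n ≥ 2 →
    let open ℝ[X] in
    (RP (friendship n) ≈ (X ^ 2 - C (fromℚ (+ 1 / 4))) ^ (n ∸ 1) * (X - C (fromℚ 1ℚ)) * (X + C (fromℚ ½)) ^ 2)
    × HasRE (friendship n) (fromℕ (n ℕ.+ 1))
theorem6 (suc m) _ = RP-friendship m , RE-friendship m
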